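{- Let $G$ be a (multi-)graph with $n$ vertices and pseudo-arboricity $a^*$, and let $\varepsilon \in (0,1)$. There is a (randomized) LOCAL algorithm which, with high probability, obtains a $\lceil a^*(1+\varepsilon) \rceil$-orientation of $G$ in $O\left( \frac{\log^3 n}{\varepsilon}\right)$ rounds.
   Context: A pseudo-forest is a graph with at most one cycle in each connected component. The pseudo-arboricity $a^*$ of a multigraph is the minimum number of pseudo-forests into which its edges can be partitioned; equivalently $a^* = \max_{H \subseteq G, |V(H)| \geq 1} \lceil |E(H)|/|V(H)| \rceil$. A $k$-orientation of a graph is an orientation of its edges in which every vertex has outdegree at most $k$. LOCAL model: the input graph is the communication network; the vertices operate in synchronized rounds, in each of which every vertex exchanges messages of arbitrary size with its neighbors and performs arbitrary local computation (possibly with private random bits). Each vertex has a unique ID, a binary string of length $O(\log n)$. Equivalently, in an $r$-round algorithm each vertex computes its output from the information in its $r$-hop neighborhood. Global parameters such as $n, \Delta, a^*, \varepsilon$ are known to all vertices (technically, as given upper bounds, to which the symbols then refer). "With high probability" means with probability at least $1 - 1/\mathrm{poly}(n)$. The constant in $O(\cdot)$ is universal. -}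

module Defs where

open import Data.Bool using (Bool; true; false; not)
import Data.Bool.Properties as Bool
open import Data.Fin using (Fin)
open import Data.Fin.Properties using (_≟_; all?)
import Data.Integer as ℤ
open import Data.List using (List; []; _∷_; map; length; filter; allFin; cartesianProduct; cartesianProductWith)
open import Data.List.Membership.Propositional using (_∈_)
open import Data.List.Relation.Unary.All using (All)
open import Data.List.Relation.Unary.Unique.Propositional using (Unique)
open import Data.Nat using (ℕ; zero; suc; _*_; _^_; _≤_)
import Data.Nat.Properties as ℕ
open import Data.Product using (Σ; Σ-syntax; ∃; ∃-syntax; _×_; _,_; proj₁; proj₂)
open import Data.Rational as ℚ using (ℚ)
open import Data.Sum using (_⊎_)
open import Data.Vec using (Vec; lookup; tabulate)
import Data.Vec as Vec
open import Function using (_∘_)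
open import Function.Bundles using (_⇔_; _↔_; Inverse)
open import Function.Definitions using (Injective)
open import Level using (0ℓ)
open import Relation.Binary.Construct.Closure.ReflexiveTransitive using (Star)
open import Relation.Binary.PropositionalEquality using (_≡_; _≢_; refl)
open import Relation.Nullary using (¬_; Dec; ¬?; _×-dec_)
open import Relation.Unary using (Pred; Decidable)

------------------------------------------------------------------------
-- Real numbers, as Dedekind cuts

record ℝ : Set₁ where
  field
    L U         : Pred ℚ 0ℓ
    L-inhabited : ∃ L
    U-inhabited : ∃ U
    L-rounded   : ∀ p → L p ⇔ (∃[ q ] p ℚ.< q × L q)
    U-rounded   : ∀ q → U q ⇔ (∃[ p ] p ℚ.< q × U p)
    disjoint    : ∀ q → ¬ (L q × U q)
    located     : ∀ p q → p ℚ.< q → L p ⊎ U q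

fromℕ : ℕ → ℚ
fromℕ n = ℤ.+ n ℚ./ 1

-- ε ∈ (0,1)
InUnitInterval : ℝ → Set
InUnitInterval ε = ℝ.L ε ℚ.0ℚ × ℝ.U ε ℚ.1ℚ

-- The real inequality  a (1 + ε) ≤ k .  Since ε is the supremum of its lower
-- cut, it holds iff it holds with ε replaced by every rational q < ε.
[_*1+_]≤_ : ℕ → ℝ → ℕ → Set
[ a *1+ ε ]≤ k = ∀ q → ℝ.L ε q → fromℕ a ℚ.* (ℚ.1ℚ ℚ.+ q) ℚ.≤ fromℕ k

-- k = ⌈ a (1 + ε) ⌉ .  A relation, because the ceiling of a real number is not
-- a computable function.
_≡⌈_*1+_⌉ : ℕ → ℕ → ℝ → Set
k ≡⌈ a *1+ ε ⌉ = [ a *1+ ε ]≤ k × (∀ k′ → [ a *1+ ε ]≤ k′ → k ≤ k′)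

-- For ε > 0, the real inequality  r ≤ x / ε , i.e.  r ε ≤ x .
_≤[_/_] : ℕ → ℕ → ℝ → Set
r ≤[ x / ε ] = ∀ q → ℝ.L ε q → fromℕ r ℚ.* q ℚ.≤ fromℕ x

------------------------------------------------------------------------
-- Multigraphs

-- Parallel edges and loops are allowed.  The order of the two ends of an edge
-- has no meaning; it only serves to name the two halves of the edge.
record Multigraph : Set where
  field
    #V   : ℕ
    #E   : ℕ
    ends : Fin #E → Fin #V × Fin #V

module _ (G : Multigraph) where
  open Multigraph G

  Vertex : Set
  Vertex = Fin #V

  Edge : Set
  Edge = Fin #E

  -- An edge together with a direction of traversal, equivalently a half-edge
  -- (the half at the tail).  A loop has two darts with the same tail.
  Dart : Set
  Dart = Edge × Bool

  edge : Dart → Edge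
  edge = proj₁

  reverse : Dart → Dart
  reverse (e , s) = e , not s

  tail : Dart → Vertex
  tail (e , false) = proj₁ (ends e)
  tail (e , true)  = proj₂ (ends e)

  head : Dart → Vertex
  head h = tail (reverse h)

  darts : List Dart
  darts = cartesianProduct (allFin #E) (false ∷ true ∷ [])

  -- A loop contributes two.
  degree : Vertex → ℕ
  degree v = length (filter (λ h → tail h ≟ v) darts)

  ----------------------------------------------------------------------
  -- Pseudo-forests.  F is a set of edges, standing for the spanning
  -- subgraph with edge set F.

  Adjacent : Pred Edge 0ℓ → Vertex → Vertex → Set
  Adjacent F u v = Σ[ h ∈ Dart ] F (edge h) × tail h ≡ u × head h ≡ v

  Connected : Pred Edge 0ℓ → Vertex → Vertex → Set
  Connected F = Star (Adjacent F)

  IsWalk : Vertex → List Dart → Vertex → Set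
  IsWalk u []       v = u ≡ v
  IsWalk u (h ∷ hs) v = tail h ≡ u × IsWalk (head h) hs v

  -- Distinctness of the edges excludes going back and forth along one edge;
  -- a loop is a cycle of length one, two parallel edges form a cycle of
  -- length two.
  record IsCycle (F : Pred Edge 0ℓ) (u : Vertex) (hs : List Dart) : Set where
    field
      nonempty          : hs ≢ []
      closed            : IsWalk u hs u
      distinct-vertices : Unique (map tail hs)
      distinct-edges    : Unique (map edge hs)
      inside            : All (F ∘ edge) hs

  -- Two cycles are the same when they have the same edges, irrespective of
  -- starting point and direction of traversal.
  IsPseudoForest : Pred Edge 0ℓ → Set
  IsPseudoForest F =
    ∀ u u′ hs hs′ → IsCycle F u hs → IsCycle F u′ hs′ → Connected F u u′ →
    ∀ e → e ∈ map edge hs ⇔ e ∈ map edge hs′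

  PartitionsIntoPseudoForests : ℕ → Set
  PartitionsIntoPseudoForests k =
    Σ[ part ∈ (Edge → Fin k) ] ∀ j → IsPseudoForest (λ e → part e ≡ j)

  IsPseudoArboricity : ℕ → Set
  IsPseudoArboricity a =
    PartitionsIntoPseudoForests a × (∀ k → PartitionsIntoPseudoForests k → a ≤ k)

  ----------------------------------------------------------------------
  -- Orientations.  A labelling ℓ of darts says for each edge, seen from each
  -- of its ends, whether it is directed away from that end (true) or towards
  -- it (false); it is an orientation if the two ends always disagree.

  IsOrientation : (Dart → Bool) → Set
  IsOrientation ℓ = ∀ e → ℓ (e , true) ≡ not (ℓ (e , false))

  outdegree : (Dart → Bool) → Vertex → ℕ
  outdegree ℓ v = length (filter (λ h → (tail h ≟ v) ×-dec (ℓ h Bool.≟ true)) darts)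

  _-IsOrientation_ : ℕ → (Dart → Bool) → Set
  k -IsOrientation ℓ = IsOrientation ℓ × (∀ v → outdegree ℓ v ≤ k)

  _-isOrientation?_ : ∀ k ℓ → Dec (k -IsOrientation ℓ)
  k -isOrientation? ℓ =
    all? (λ e → ℓ (e , true) Bool.≟ not (ℓ (e , false)))
      ×-dec all? (λ v → outdegree ℓ v ℕ.≤? k)

------------------------------------------------------------------------
-- The LOCAL model

ID : Set
ID = List Bool

-- The program run by every vertex.  A vertex of degree d refers to its
-- incident half-edges by port numbers in Fin d, and starts out knowing only
-- d, its own ID, and its b private random bits.  In each round it sends one
-- message of arbitrary size through each port, and updates its state from the
-- messages received through its ports.  In the end it outputs one bit for each
-- port.
record LocalAlgorithm (b : ℕ) : Set₁ where
  field
    State   : ℕ → Set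
    Message : Set
    init    : ∀ d → ID → Vec Bool b → State d
    send    : ∀ {d} → State d → Vec Message d
    receive : ∀ {d} → State d → Vec Message d → State d
    output  : ∀ {d} → State d → Vec Bool d

-- Unique IDs of length at most s, and an arbitrary numbering of the ports of
-- each vertex.
record Network (G : Multigraph) (s : ℕ) : Set where
  field
    id        : Vertex G → ID
    id-unique : Injective _≡_ _≡_ id
    id-length : ∀ v → length (id v) ≤ s
    ports     : ∀ v → Fin (degree G v) ↔ (Σ[ h ∈ Dart G ] tail G h ≡ v)

  dartAt : ∀ v → Fin (degree G v) → Dart G
  dartAt v i = proj₁ (Inverse.to (ports v) i)

  portOf : (h : Dart G) → Fin (degree G (tail G h))
  portOf h = Inverse.from (ports (tail G h)) (h , refl)

-- The random bits of all the vertices.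
Outcome : Multigraph → ℕ → Set
Outcome G b = Vec (Vec Bool b) (Multigraph.#V G)

module Execution {G s b} (N : Network G s) (𝒜 : LocalAlgorithm b) (ω : Outcome G b) where
  open Network N
  open LocalAlgorithm 𝒜

  state : ℕ → ∀ v → State (degree G v)
  state zero    v = init (degree G v) (id v) (lookup ω v)
  state (suc t) v = receive (state t v) (tabulate (λ i → incoming (reverse G (dartAt v i))))
    where
    -- the message sent along the dart h by its tail
    incoming : Dart G → Message
    incoming h = lookup (send (state t (tail G h))) (portOf h)

  -- The label given to each half-edge by the vertex it is at, after r rounds.
  labelling : ℕ → Dart G → Bool
  labelling r h = lookup (output (state r (tail G h))) (portOf h)

------------------------------------------------------------------------
-- Probability

allVecs : ∀ {A : Set} → List A → ∀ n → List (Vec A n)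
allVecs xs zero    = Vec.[] ∷ []
allVecs xs (suc n) = cartesianProductWith Vec._∷_ xs (allVecs xs n)

-- The sample space, with the uniform distribution: every outcome occurs once.
outcomes : ∀ G b → List (Outcome G b)
outcomes G b = allVecs (allVecs (false ∷ true ∷ []) b) (Multigraph.#V G)

-- Pr[ P ] ≥ 1 − 1 / n ^ c , i.e. n ^ c · Pr[ ¬ P ] ≤ 1 .
WithProbability≥1-1/_^_ : ∀ (n c : ℕ) {G b} {P : Pred (Outcome G b) 0ℓ} → Decidable P → Set
WithProbability≥1-1/_^_ n c {G} {b} P? =
  n ^ c * length (filter (¬? ∘ P?) (outcomes G b)) ≤ length (outcomes G b)

-- 𝒜, run for r rounds on N, gives a k-orientation with probability at least
-- 1 − 1 / n ^ c .
ObtainsOrientation : ∀ {G s b} → Network G s → LocalAlgorithm b → (r k n c : ℕ) → Set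
ObtainsOrientation {G} {b = b} N 𝒜 r k n c =
  WithProbability≥1-1/_^_ n c {G} {b}
    {λ ω → _-IsOrientation_ G k (Execution.labelling N 𝒜 ω r)}
    (λ ω → _-isOrientation?_ G k (Execution.labelling N 𝒜 ω r))

{-# OPTIONS --safe #-}
module Submission where

-- An orientation is built from partial orientations in which a dart labelled true
-- is owned by its tail and every vertex owns at most k darts.  An unoriented edge
-- at v can be oriented by an augmenting path of length R = O(log n / ε): otherwise
-- the sets of vertices reachable from v along owned darts grow by a factor 1 + ε
-- in each of R steps, because a set of s vertices spans at most a s edges.
--
-- In each of T = O(log n) phases, every vertex y draws a radius X_y from a truncated
-- geometric distribution, and every vertex joins the first y, in the order of the
-- keys, with dist ≤ 2 R X_y.  Each cluster then solves its own problem: orient all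
-- edges at vertices whose R-ball lies in the cluster, changing only edges inside
-- the cluster.  Geometric radii being memoryless, the R-ball of a given vertex is cut
-- in a phase with probability at most 5/8, independently of the other phases.
--
-- All communication is the collection of views; the labels computed in each phase
-- are functions of the view, so that a phase costs its locality, O(R log n).

open import Defs
open import Data.Bool using (Bool; true; false; not; if_then_else_)
import Data.Bool.Properties as Bool
open import Data.Empty using (⊥; ⊥-elim)
open import Data.Fin as Fin using (Fin; zero; suc; toℕ)
open import Data.Fin.Properties as Fin using (_≟_; all?; any?; ¬∀⟶∃¬; toℕ<n; toℕ-injective; toℕ-fromℕ<)
import Data.Integer as ℤ
import Data.Integer.Properties as ℤ
open import Data.List as List using (List; []; _∷_; _++_; map; length; filter; cartesianProductWith; allFin)
open import Data.List.Membership.DecPropositional using () renaming (_∈?_ to mem?)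
open import Data.List.Membership.Propositional using (_∈_; _∉_)
open import Data.List.Membership.Propositional.Properties using (∈-map⁺; ∈-map⁻; ∈-filter⁺; ∈-filter⁻; ∈-allFin; ∈-cartesianProduct⁺; ∈-cartesianProductWith⁺; ∈-tabulate⁺; ∈-tabulate⁻)
import Data.List.Properties as List
open import Data.List.Relation.Unary.All as All using (All; []; _∷_)
open import Data.List.Relation.Unary.AllPairs using ([]; _∷_)
open import Data.List.Relation.Unary.Any using (here; there)
open import Data.List.Relation.Unary.Unique.Propositional using (Unique)
open import Data.List.Relation.Unary.Unique.Propositional.Properties using (allFin⁺; filter⁺; cartesianProduct⁺)
open import Data.Maybe as Maybe using (Maybe; just; nothing; Is-just; maybe; _>>=_; _<∣>_)
import Data.Maybe.Properties as Maybe
open import Data.Maybe.Relation.Unary.All as MaybeAll using (just; nothing)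
import Data.Maybe.Relation.Unary.Any as MaybeAny
open import Data.Nat as ℕ using (ℕ; zero; suc; _+_; _*_; _^_; _∸_; _≤_; _<_; z≤n; s≤s; _<?_; _≤?_; ⌊_/2⌋; ⌈_/2⌉; NonZero; >-nonZero)
import Data.Nat.Coprimality as Coprime
open import Data.Nat.DivMod using (_mod_; m<n⇒m%n≡m)
open import Data.Nat.Induction using (<-rec)
open import Data.Nat.ListAction using (sum)
open import Data.Nat.Logarithm using (⌈log₂_⌉; ⌈log₂⌉-mono-≤; ⌈log₂⌈n/2⌉⌉≡⌈log₂n⌉∸1)
open import Data.Nat.Properties hiding (_≟_)
open import Data.Nat.Solver using (module +-*-Solver)
open import Data.Product using (Σ-syntax; ∃; ∃-syntax; _×_; _,_; proj₁; proj₂; swap)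
import Data.Product.Properties as Product
open import Data.Rational as ℚ using (ℚ; mkℚ)
import Data.Rational.Properties as ℚ
open import Data.Rational.Unnormalised as ℚᵘ using (mkℚᵘ)
import Data.Rational.Unnormalised.Properties as ℚᵘ
open import Data.Sum as Sum using (_⊎_; inj₁; inj₂)
open import Data.Unit using (⊤; tt)
open import Data.Vec as Vec using (Vec; []; _∷_; lookup; tabulate; _[_]≔_)
open import Data.Vec.Properties as Vec using (lookup∘tabulate; lookup∘update; lookup∘update′; lookup-map; lookup-replicate; tabulate-cong; tabulate∘lookup)
open import Function using (_∘_; id)
open import Function.Bundles using (Equivalence; Inverse)
open import Function.Definitions using (Injective)
open import Level using (0ℓ)
open import Relation.Binary.Construct.Closure.ReflexiveTransitive as Star using (ε; _◅_; _◅◅_)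
open import Relation.Binary.Definitions using (DecidableEquality; tri<; tri≈; tri>)
open import Relation.Binary.PropositionalEquality
open import Relation.Nullary using (¬_; Dec; yes; no; does; ¬?; _×-dec_; _⊎-dec_; _→-dec_)
open import Relation.Nullary.Decidable using (dec-true; map′)
open import Relation.Unary using (Pred; Decidable; _⊆_)

-- Sums over lists

-- Augmenting paths of different edges may run through the same vertices and cannot be used in
-- parallel without coordination. The clusters of a phase are disjoint and every edge that leaves a
-- cluster is frozen, so all clusters can act at once. An edge at a vertex whose ball is cut can
-- wait for another phase: edges once oriented stay oriented, though perhaps in the other direction.
-- This is why padding with constant probability per phase is enough.
--
-- A cluster does not carry out the augmentations. It searches all labellings of a finite table in a
-- fixed order, and the augmentations only show that the search succeeds. Members then need not
-- exchange a solution, because equal tables give equal solutions; the work on views serves to show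
-- that the tables are equal.
--
-- `ε` is a Dedekind cut, and comparing it with rationals is undecidable. The combinatorial part
-- therefore uses a natural number m with k ≥ a (1 + 1/(m+1)), and states growth rates and
-- probabilities as inequalities between natural numbers.

∑ : {A : Set} → List A → (A → ℕ) → ℕ
∑ xs f = sum (map f xs)

𝟙 : {P : Set} → Dec P → ℕ
𝟙 P? = if does P? then 1 else 0

𝟙-yes : {P : Set} (P? : Dec P) → P → 𝟙 P? ≡ 1
𝟙-yes (yes _) _ = refl
𝟙-yes (no ¬p) p = ⊥-elim (¬p p)

𝟙-no : {P : Set} (P? : Dec P) → ¬ P → 𝟙 P? ≡ 0
𝟙-no (yes p) ¬p = ⊥-elim (¬p p)
𝟙-no (no _)  _  = refl

𝟙≤ : {P : Set} (P? : Dec P) {k : ℕ} → (P → 1 ≤ k) → 𝟙 P? ≤ k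
𝟙≤ (yes p) h = h p
𝟙≤ (no _)  _ = z≤n

𝟙-mono : {P Q : Set} (P? : Dec P) (Q? : Dec Q) → (P → Q) → 𝟙 P? ≤ 𝟙 Q?
𝟙-mono P? Q? f = 𝟙≤ P? (λ p → ≤-reflexive (sym (𝟙-yes Q? (f p))))

module _ {A : Set} where

  ∑-mono : (xs : List A) {f g : A → ℕ} → (∀ x → f x ≤ g x) → ∑ xs f ≤ ∑ xs g
  ∑-mono []       h = z≤n
  ∑-mono (x ∷ xs) h = +-mono-≤ (h x) (∑-mono xs h)

  ∑-cong : (xs : List A) {f g : A → ℕ} → (∀ x → f x ≡ g x) → ∑ xs f ≡ ∑ xs g
  ∑-cong []       h = refl
  ∑-cong (x ∷ xs) h = cong₂ _+_ (h x) (∑-cong xs h)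

  ∑-+ : (xs : List A) (f g : A → ℕ) → ∑ xs (λ x → f x + g x) ≡ ∑ xs f + ∑ xs g
  ∑-+ []       f g = refl
  ∑-+ (x ∷ xs) f g rewrite ∑-+ xs f g =
    solve 4 (λ a b c d → (a :+ b) :+ (c :+ d) := (a :+ c) :+ (b :+ d)) refl
      (f x) (g x) (∑ xs f) (∑ xs g)
    where open +-*-Solver

  ∑-*ˡ : (xs : List A) (c : ℕ) (f : A → ℕ) → ∑ xs (λ x → c * f x) ≡ c * ∑ xs f
  ∑-*ˡ []       c f = sym (*-zeroʳ c)
  ∑-*ˡ (x ∷ xs) c f rewrite ∑-*ˡ xs c f = sym (*-distribˡ-+ c (f x) (∑ xs f))

  ∑-*ʳ : (xs : List A) (c : ℕ) (f : A → ℕ) → ∑ xs (λ x → f x * c) ≡ ∑ xs f * c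
  ∑-*ʳ xs c f = trans (∑-cong xs (λ x → *-comm (f x) c)) (trans (∑-*ˡ xs c f) (*-comm c (∑ xs f)))

  ∑-const : (xs : List A) (c : ℕ) → ∑ xs (λ _ → c) ≡ length xs * c
  ∑-const []       c = refl
  ∑-const (x ∷ xs) c = cong (c +_) (∑-const xs c)

  ∑-++ : (xs ys : List A) (f : A → ℕ) → ∑ (xs ++ ys) f ≡ ∑ xs f + ∑ ys f
  ∑-++ []       ys f = refl
  ∑-++ (x ∷ xs) ys f rewrite ∑-++ xs ys f = sym (+-assoc (f x) (∑ xs f) (∑ ys f))

  ∑-∈ : {xs : List A} (f : A → ℕ) {x : A} → x ∈ xs → f x ≤ ∑ xs f
  ∑-∈ f (here refl) = m≤m+n _ _
  ∑-∈ f (there x∈) = ≤-trans (∑-∈ f x∈) (m≤n+m _ _)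

  length-filter : {P : Pred A 0ℓ} (P? : Decidable P) (xs : List A) →
                  length (filter P? xs) ≡ ∑ xs (λ x → 𝟙 (P? x))
  length-filter P? [] = refl
  length-filter P? (x ∷ xs) with P? x
  ... | yes _ = cong suc (length-filter P? xs)
  ... | no  _ = length-filter P? xs

  ∑-none : (xs : List A) {P : Pred A 0ℓ} (P? : Decidable P) →
           All (λ x → ¬ P x) xs → ∑ xs (λ x → 𝟙 (P? x)) ≡ 0
  ∑-none []       P? []        = refl
  ∑-none (x ∷ xs) P? (¬p ∷ ¬ps) = cong₂ _+_ (𝟙-no (P? x) ¬p) (∑-none xs P? ¬ps)

  ∑-atMostOne : {xs : List A} → Unique xs → {P : Pred A 0ℓ} (P? : Decidable P) →
                (∀ x y → P x → P y → x ≡ y) → ∑ xs (λ x → 𝟙 (P? x)) ≤ 1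
  ∑-atMostOne []        P? h = z≤n
  ∑-atMostOne {x ∷ xs} (x∉ ∷ u) P? h with P? x
  ... | yes p = s≤s (≤-reflexive (∑-none xs P? (All.map (λ x≢y q → x≢y (h _ _ p q)) x∉)))
  ... | no  _ = ∑-atMostOne u P? h

  remove : {x : A} {xs : List A} → x ∈ xs →
           Σ[ ys ∈ List A ] length xs ≡ suc (length ys) × (∀ {y} → y ∈ xs → y ≡ x ⊎ y ∈ ys)
  remove {xs = _ ∷ xs} (here refl) = xs , refl , λ { (here p) → inj₁ p ; (there q) → inj₂ q }
  remove {xs = z ∷ _} (there x∈) with ys , eq , f ← remove x∈ =
    z ∷ ys , cong suc eq ,
    λ { (here p) → inj₂ (here p)
      ; (there q) → Sum.map₂ there (f q) }

∑-swap : {A B : Set} (xs : List A) (ys : List B) (f : A → B → ℕ) →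
         ∑ xs (λ x → ∑ ys (f x)) ≡ ∑ ys (λ y → ∑ xs (λ x → f x y))
∑-swap []       ys f = sym (trans (∑-const ys 0) (*-zeroʳ (length ys)))
∑-swap (x ∷ xs) ys f =
  trans (cong (∑ ys (f x) +_) (∑-swap xs ys f)) (sym (∑-+ ys (f x) (λ y → ∑ xs (λ x′ → f x′ y))))

∑-map : {A B : Set} (g : A → B) (xs : List A) (f : B → ℕ) → ∑ (map g xs) f ≡ ∑ xs (λ x → f (g x))
∑-map g []       f = refl
∑-map g (x ∷ xs) f = cong (f (g x) +_) (∑-map g xs f)

∑-product : {A B C : Set} (g : A → B → C) (xs : List A) (ys : List B) (f : C → ℕ) →
            ∑ (cartesianProductWith g xs ys) f ≡ ∑ xs (λ x → ∑ ys (λ y → f (g x y)))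
∑-product g []       ys f = refl
∑-product g (x ∷ xs) ys f =
  trans (∑-++ (map (g x) ys) _ f) (cong₂ _+_ (∑-map (g x) ys f) (∑-product g xs ys f))

-- Pigeonhole, with the partner of each element struck off `ys`. A relation instead of a function
-- serves to compare darts with ports in both directions, although a port need not belong to a dart.
length-injective-relation :
  {A B : Set} (_~_ : A → B → Set) {xs : List A} {ys : List B} → Unique xs →
  (∀ x → x ∈ xs → ∃[ y ] y ∈ ys × x ~ y) → (∀ {x x′ y} → x ~ y → x′ ~ y → x ≡ x′) →
  length xs ≤ length ys
length-injective-relation _~_ [] f inj = z≤n
length-injective-relation _~_ {x ∷ xs} {ys} (x∉ ∷ u) f inj
  with y , y∈ , x~y ← f x (here refl)
  with ys′ , eq , keep ← remove y∈ =
  subst (suc (length xs) ≤_) (sym eq)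
    (s≤s (length-injective-relation _~_ u step inj))
  where
  step : ∀ x′ → x′ ∈ xs → ∃[ y′ ] y′ ∈ ys′ × x′ ~ y′
  step x′ x′∈ with y′ , y′∈ , r ← f x′ (there x′∈) with keep y′∈
  ... | inj₂ q    = y′ , q , r
  ... | inj₁ refl = ⊥-elim (All.lookup x∉ x′∈ (inj x~y r))

-- Pseudo-forests are sparse

module _ (G : Multigraph) where
  open Multigraph G

  reverse-reverse : ∀ h → reverse G (reverse G h) ≡ h
  reverse-reverse (e , s) = cong (e ,_) (Bool.not-involutive s)

  same-edge : ∀ h h′ → edge G h ≡ edge G h′ → h′ ≡ h ⊎ h′ ≡ reverse G h
  same-edge (e , false) (.e , false) refl = inj₁ refl
  same-edge (e , false) (.e , true)  refl = inj₂ refl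
  same-edge (e , true)  (.e , false) refl = inj₂ refl
  same-edge (e , true)  (.e , true)  refl = inj₁ refl

  Connected-mono : ∀ {F F′ : Pred (Edge G) 0ℓ} → F ⊆ F′ → ∀ {u v} → Connected G F u v → Connected G F′ u v
  Connected-mono F⊆F′ = Star.map (λ (h , f , p) → h , F⊆F′ f , p)

  Connected-sym : ∀ {F : Pred (Edge G) 0ℓ} {u v} → Connected G F u v → Connected G F v u
  Connected-sym = Star.reverse λ (h , f , t , t′) →
    reverse G h , f , t′ , trans (cong (tail G) (reverse-reverse h)) t

  connect : ∀ {F : Pred (Edge G) 0ℓ} h → F (edge G h) → Connected G F (tail G h) (head G h)
  connect h f = (h , f , refl , refl) ◅ ε

  IsCycle-mono : ∀ {F F′ : Pred (Edge G) 0ℓ} → F ⊆ F′ → ∀ {u hs} → IsCycle G F u hs → IsCycle G F′ u hs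
  IsCycle-mono F⊆F′ C = record
    { nonempty = nonempty ; closed = closed ; distinct-vertices = distinct-vertices
    ; distinct-edges = distinct-edges ; inside = All.map F⊆F′ inside }
    where open IsCycle C

  data SimplePath (F : Pred (Edge G) 0ℓ) : Vertex G → List (Dart G) → Vertex G → Set where
    stop : ∀ {v} → SimplePath F v [] v
    go   : ∀ h {hs v} → F (edge G h) → SimplePath F (head G h) hs v →
           tail G h ∉ (v ∷ map (tail G) hs) → SimplePath F (tail G h) (h ∷ hs) v

  module _ {F : Pred (Edge G) 0ℓ} where

    start∈ : ∀ {u hs v} → SimplePath F u hs v → u ∈ (v ∷ map (tail G) hs)
    start∈ stop         = here refl
    start∈ (go h _ _ _) = there (here refl)

    weaken∈ : ∀ {x v y : Vertex G} {xs} → x ∈ (v ∷ xs) → x ∈ (v ∷ y ∷ xs)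
    weaken∈ (here p)  = here p
    weaken∈ (there p) = there (there p)

    tail∈ : ∀ {u hs v} → SimplePath F u hs v → ∀ {h} → h ∈ hs → tail G h ∈ (v ∷ map (tail G) hs)
    tail∈ _ h∈ = there (∈-map⁺ (tail G) h∈)

    head∈ : ∀ {u hs v} → SimplePath F u hs v → ∀ {h} → h ∈ hs → head G h ∈ (v ∷ map (tail G) hs)
    head∈ (go h f p ∉) (here refl) = weaken∈ (start∈ p)
    head∈ (go h f p ∉) (there h∈)  = weaken∈ (head∈ p h∈)

    walk : ∀ {u hs v} → SimplePath F u hs v → IsWalk G u hs v
    walk stop         = refl
    walk (go h _ p _) = refl , walk p

    path-inside : ∀ {u hs v} → SimplePath F u hs v → All (F ∘ edge G) hs
    path-inside stop         = []
    path-inside (go h f p _) = f ∷ path-inside p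

    ∉⇒All : ∀ {x : Vertex G} {xs} → x ∉ xs → All (x ≢_) xs
    ∉⇒All x∉ = All.tabulate λ { y∈ refl → x∉ y∈ }

    path-vertices : ∀ {u hs v} → SimplePath F u hs v → Unique (v ∷ map (tail G) hs)
    path-vertices stop = [] ∷ []
    path-vertices (go h f p ∉) with path-vertices p
    ... | v∉ ∷ u = ((λ v≡ → ∉ (here (sym v≡))) ∷ v∉) ∷ (∉⇒All (∉ ∘ there) ∷ u)

    -- A later occurrence of the edge of `h`, in either direction, would have the tail of `h` as one
    -- of its ends, and that vertex does not occur again.
    path-edges : ∀ {u hs v} → SimplePath F u hs v → Unique (map (edge G) hs)
    path-edges stop = []
    path-edges (go h {hs} {v} f p ∉) = All.tabulate fresh ∷ path-edges p
      where
      fresh : ∀ {e} → e ∈ map (edge G) hs → edge G h ≢ e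
      fresh e∈ eq with h′ , h′∈ , refl ← ∈-map⁻ (edge G) e∈ with same-edge h′ h (sym eq)
      ... | inj₁ refl = ∉ (tail∈ p h′∈)
      ... | inj₂ refl = ∉ (head∈ p h′∈)

    suffix : ∀ {u w hs v} → SimplePath F w hs v → u ∈ (v ∷ map (tail G) hs) → ∃[ hs′ ] SimplePath F u hs′ v
    suffix p (here refl) = [] , stop
    suffix p@(go _ _ _ _) (there (here refl)) = _ , p
    suffix (go _ _ p _) (there (there q)) = suffix p (there q)

    simple : ∀ {u v} → Connected G F u v → ∃[ hs ] SimplePath F u hs v
    simple ε = [] , stop
    simple {v = v} ((h , f , refl , refl) ◅ c) with hs , p ← simple c
      with mem? _≟_ (tail G h) (v ∷ map (tail G) hs)
    ... | yes q = suffix p q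
    ... | no  q = _ , go h f p q

  -- A simple path inside `F` avoids the edge of `h`; this covers loops, where the path is empty,
  -- and parallel edges. `F′` is kept separate because the cycle is wanted once in the enlarged edge
  -- list and once in the whole pseudo-forest.
  close-cycle : ∀ {F F′ : Pred (Edge G) 0ℓ} → F ⊆ F′ → ∀ h → ¬ F (edge G h) → F′ (edge G h) →
                Connected G F (head G h) (tail G h) →
                ∃[ hs ] IsCycle G F′ (tail G h) (h ∷ hs)
  close-cycle F⊆F′ h ∉F ∈F′ c with hs , p ← simple c = hs , record
    { nonempty          = λ ()
    ; closed            = refl , walk p
    ; distinct-vertices = path-vertices p
    ; distinct-edges    = All.tabulate (λ e∈ → λ { refl → ∉F (inside∈ e∈) }) ∷ path-edges p
    ; inside            = ∈F′ ∷ All.map F⊆F′ (path-inside p) }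
    where
    inside∈ : ∀ {e} → e ∈ map (edge G) hs → _
    inside∈ e∈ with h′ , h′∈ , refl ← ∈-map⁻ (edge G) e∈ = All.lookup (path-inside p) h′∈

  walk-connected : ∀ {F : Pred (Edge G) 0ℓ} {u v} hs → IsWalk G u hs v → All (F ∘ edge G) hs →
                   ∀ {h} → h ∈ hs → Connected G F u (tail G h)
  walk-connected (h ∷ hs) (refl , w) (f ∷ fs) (here refl) = ε
  walk-connected (h ∷ hs) (refl , w) (f ∷ fs) (there h∈)  =
    connect h f ◅◅ walk-connected hs w fs h∈

  cycles-sharing-an-edge : ∀ {F : Pred (Edge G) 0ℓ} {u hs u′ hs′} → IsCycle G F u hs → IsCycle G F u′ hs′ →
                           ∀ {e} → e ∈ map (edge G) hs → e ∈ map (edge G) hs′ → Connected G F u u′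
  cycles-sharing-an-edge {hs = hs} {hs′ = hs′} C C′ e∈ e∈′
    with h , h∈ , refl ← ∈-map⁻ (edge G) e∈
    with h′ , h′∈ , eq ← ∈-map⁻ (edge G) e∈′ = to-h ◅◅ between ◅◅ Connected-sym to-h′
    where
    to-h  = walk-connected hs (IsCycle.closed C) (IsCycle.inside C) h∈
    to-h′ = walk-connected hs′ (IsCycle.closed C′) (IsCycle.inside C′) h′∈
    between : Connected G _ (tail G h) (tail G h′)
    between with same-edge h h′ eq
    ... | inj₁ refl = ε
    ... | inj₂ refl = connect h (All.lookup (IsCycle.inside C) h∈)

  module _ {F : Pred (Edge G) 0ℓ} (pf : IsPseudoForest G F) (S : List (Vertex G)) where

    Rooted : List (Edge G) → List (Vertex G) → Vertex G → Set
    Rooted es W u = ∃[ w ] w ∈ W × Connected G (_∈ es) u w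

    Cyclic : List (Edge G) → Vertex G → Set
    Cyclic es u = ∃[ c ] ∃[ hs ] IsCycle G (_∈ es) c hs × Connected G (_∈ es) u c

    -- The edge of `h` would put two cycles into one component of `F`, so these have the same edges.
    -- The ends of `h` are then already connected within `es`, and `h` closes a further cycle, which
    -- must again have the edges of the first. But that one lies in `es` and misses `h`.
    one-cycle : ∀ {es} → (_∈ es) ⊆ F → ∀ h → F (edge G h) → edge G h ∉ es →
                Cyclic es (tail G h) → ¬ Cyclic es (head G h)
    one-cycle {es} es⊆F h f h∉ (c , [] , C , t~c) _ = IsCycle.nonempty C refl
    one-cycle {es} es⊆F h f h∉ (c , g ∷ gs , C , t~c) (c′ , hs′ , C′ , h~c′) =
      h∉ (All.lookup inside-es (Equivalence.from sameedges (here refl)))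
      where
      inF : ∀ {u hs} → IsCycle G (_∈ es) u hs → IsCycle G F u hs
      inF = IsCycle-mono es⊆F
      lift : ∀ {u v} → Connected G (_∈ es) u v → Connected G F u v
      lift = Connected-mono es⊆F
      shared : edge G g ∈ map (edge G) hs′
      shared = Equivalence.to
        (pf c c′ _ _ (inF C) (inF C′) (Connected-sym (lift t~c) ◅◅ connect h f ◅◅ lift h~c′) (edge G g))
        (here refl)
      joined : Connected G (_∈ es) (head G h) (tail G h)
      joined = h~c′ ◅◅ Connected-sym (cycles-sharing-an-edge C C′ (here refl) shared) ◅◅ Connected-sym t~c
      closing = close-cycle es⊆F h h∉ f joined
      sameedges = pf c (tail G h) _ _ (inF C) (proj₂ closing) (Connected-sym (lift t~c)) (edge G h)
      inside-es : All (_∈ es) (map (edge G) (g ∷ gs))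
      inside-es = All.tabulate λ e∈ → aux (∈-map⁻ (edge G) e∈)
        where
        aux : ∀ {e} → ∃[ h′ ] h′ ∈ (g ∷ gs) × e ≡ edge G h′ → e ∈ es
        aux (h′ , h′∈ , refl) = All.lookup (IsCycle.inside C) h′∈

    -- Meant as one root in `W` for each component that is still a tree. A new edge either joins two
    -- components, not both with a cycle, or closes the cycle of a tree; it costs one root in either
    -- case, and no components have to be counted.
    Rooting : List (Edge G) → Set
    Rooting es = Σ[ W ∈ List (Vertex G) ] length es + length W ≡ length S ×
                 (∀ u → u ∈ S → Rooted es W u ⊎ Cyclic es u)

    module _ {es : List (Edge G)} {W : List (Vertex G)}
             (size : length es + length W ≡ length S)
             (covered : ∀ u → u ∈ S → Rooted es W u ⊎ Cyclic es u)
             (h : Dart G) (h∉ : edge G h ∉ es) where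

      private
        es⁺ = edge G h ∷ es

        wider : ∀ {u v} → Connected G (_∈ es) u v → Connected G (_∈ es⁺) u v
        wider = Connected-mono there

      -- The root of the component of the tail of h is given up: afterwards that
      -- component either shares the root of the head or contains a cycle.
      drop-root : ∀ {w} → w ∈ W → Connected G (_∈ es) (tail G h) w →
                  Rooted es W (head G h) ⊎ Cyclic es (head G h) → Rooting es⁺
      drop-root {w} w∈ t~w other with W⁻ , eq , keep ← remove w∈ =
        W⁻ , trans (sym (+-suc (length es) (length W⁻))) (trans (cong (length es +_) (sym eq)) size) , covered⁺
        where
        Covered⁺ : Vertex G → Set
        Covered⁺ u = Rooted es⁺ W⁻ u ⊎ Cyclic es⁺ u

        extend : ∀ {u v} → Connected G (_∈ es⁺) u v → Covered⁺ v → Covered⁺ u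
        extend c (inj₁ (w′ , w′∈ , c′)) = inj₁ (w′ , w′∈ , c ◅◅ c′)
        extend c (inj₂ (o , hs , C , c′)) = inj₂ (o , hs , C , c ◅◅ c′)

        tail⁺ : Rooted es W (head G h) ⊎ Cyclic es (head G h) → Covered⁺ (tail G h)
        tail⁺ (inj₂ (o , hs , C , c)) =
          inj₂ (o , hs , IsCycle-mono there C , connect h (here refl) ◅◅ wider c)
        tail⁺ (inj₁ (w′ , w′∈ , c)) with keep w′∈
        ... | inj₂ w′∈⁻ = inj₁ (w′ , w′∈⁻ , connect h (here refl) ◅◅ wider c)
        ... | inj₁ refl =
                inj₂ (tail G h , _ , proj₂ (close-cycle there h h∉ (here refl) (c ◅◅ Connected-sym t~w)) , ε)

        covered⁺ : ∀ u → u ∈ S → Covered⁺ u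
        covered⁺ u u∈ with covered u u∈
        ... | inj₂ (o , hs , C , c) = inj₂ (o , hs , IsCycle-mono there C , wider c)
        ... | inj₁ (w′ , w′∈ , c) with keep w′∈
        ...   | inj₂ w′∈⁻ = inj₁ (w′ , w′∈⁻ , wider c)
        ...   | inj₁ refl = extend (wider (c ◅◅ Connected-sym t~w)) (tail⁺ other)

    rooting : ∀ es → Unique es → (_∈ es) ⊆ F → (∀ h → edge G h ∈ es → tail G h ∈ S) → Rooting es
    rooting [] _ _ _ = S , refl , λ u u∈ → inj₁ (u , u∈ , ε)
    rooting (e ∷ es) (e∉ ∷ uniq) es⊆F inS
      with W , size , covered ← rooting es uniq (es⊆F ∘ there) (λ h h∈ → inS h (there h∈))
      with covered (tail G (e , false)) (inS (e , false) (here refl))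
         | covered (tail G (e , true)) (inS (e , true) (here refl))
    ... | inj₁ (w , w∈ , c) | other = drop-root size covered (e , false) (λ e∈ → All.lookup e∉ e∈ refl) w∈ c other
    ... | other@(inj₂ _) | inj₁ (w , w∈ , c) = drop-root size covered (e , true) (λ e∈ → All.lookup e∉ e∈ refl) w∈ c other
    ... | inj₂ x | inj₂ y =
      ⊥-elim (one-cycle (es⊆F ∘ there) (e , false) (es⊆F (here refl)) (λ e∈ → All.lookup e∉ e∈ refl) x y)

    pseudoForest-sparse : ∀ es → Unique es → (_∈ es) ⊆ F → (∀ h → edge G h ∈ es → tail G h ∈ S) →
                          length es ≤ length S
    pseudoForest-sparse es u es⊆F inS with W , size , _ ← rooting es u es⊆F inS =
      subst (length es ≤_) size (m≤m+n _ _)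

  module _ {S : Pred (Vertex G) 0ℓ} (S? : Decidable S) where

    Inside : Pred (Edge G) 0ℓ
    Inside e = S (proj₁ (ends e)) × S (proj₂ (ends e))

    Inside? : Decidable Inside
    Inside? e = S? (proj₁ (ends e)) ×-dec S? (proj₂ (ends e))

    density : ∀ {a} → PartitionsIntoPseudoForests G a →
              ∑ (allFin #E) (λ e → 𝟙 (Inside? e)) ≤ a * ∑ (allFin #V) (λ v → 𝟙 (S? v))
    density {a} (part , pfs) = begin
      ∑ (allFin #E) (λ e → 𝟙 (Inside? e))
        ≤⟨ ∑-mono (allFin #E) (λ e → 𝟙≤ (Inside? e) (λ i →
             ≤-trans (≤-reflexive (sym (𝟙-yes (in? e (part e)) (i , refl)))) (∑-∈ _ (∈-allFin (part e))))) ⟩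
      ∑ (allFin #E) (λ e → ∑ (allFin a) (λ j → 𝟙 (in? e j)))
        ≡⟨ ∑-swap (allFin #E) (allFin a) (λ e j → 𝟙 (in? e j)) ⟩
      ∑ (allFin a) (λ j → ∑ (allFin #E) (λ e → 𝟙 (in? e j)))
        ≤⟨ ∑-mono (allFin a) class ⟩
      ∑ (allFin a) (λ _ → ∑ (allFin #V) (λ v → 𝟙 (S? v)))
        ≡⟨ ∑-const (allFin a) _ ⟩
      length (allFin a) * ∑ (allFin #V) (λ v → 𝟙 (S? v))
        ≡⟨ cong (_* _) (List.length-tabulate {n = a} id) ⟩
      a * ∑ (allFin #V) (λ v → 𝟙 (S? v)) ∎
      where
      open ≤-Reasoning
      in? : ∀ e j → Dec (Inside e × part e ≡ j)
      in? e j = Inside? e ×-dec (part e ≟ j)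
      class : ∀ j → ∑ (allFin #E) (λ e → 𝟙 (in? e j)) ≤ ∑ (allFin #V) (λ v → 𝟙 (S? v))
      class j = begin
        ∑ (allFin #E) (λ e → 𝟙 (in? e j))   ≡⟨ length-filter (λ e → in? e j) (allFin #E) ⟨
        length es                            ≤⟨ pseudoForest-sparse (pfs j) vs es
                                                 (filter⁺ (λ e → in? e j) (allFin⁺ #E))
                                                 (λ e∈ → proj₂ (proj₂ (∈-filter⁻ (λ e → in? e j) {xs = allFin #E} e∈))) inS ⟩
        length vs                            ≡⟨ length-filter S? (allFin #V) ⟩
        ∑ (allFin #V) (λ v → 𝟙 (S? v))       ∎
        where
        es = filter (λ e → in? e j) (allFin #E)
        vs = filter S? (allFin #V)
        inS : ∀ h → edge G h ∈ es → tail G h ∈ vs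
        inS (e , s) e∈ with _ , (p , q) , _ ← ∈-filter⁻ (λ e → in? e j) {xs = allFin #E} e∈ with s
        ... | false = ∈-filter⁺ S? (∈-allFin _) p
        ... | true  = ∈-filter⁺ S? (∈-allFin _) q

-- Augmenting partial orientations

false≢true : false ≢ true
false≢true ()

Fin⇒0< : ∀ {n} → Fin n → 0 < n
Fin⇒0< {suc n} _ = s≤s z≤n

bernoulli : ∀ m i → m ^ suc i + suc i * m ^ i ≤ suc m ^ suc i
bernoulli m zero = ≤-reflexive (solve 1 (λ m → m :* con 1 :+ (con 1 :* con 1) := (con 1 :+ m) :* con 1) refl m)
  where open +-*-Solver
bernoulli m (suc i) = begin
  m ^ suc (suc i) + suc (suc i) * m ^ suc i
    ≡⟨ solve 3 (λ m p i → m :* (m :* p) :+ (con 2 :+ i) :* (m :* p)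
                        := m :* (m :* p :+ (con 1 :+ i) :* p) :+ m :* p) refl m (m ^ i) i ⟩
  m * (m ^ suc i + suc i * m ^ i) + m ^ suc i
    ≤⟨ +-mono-≤ (*-monoʳ-≤ m (bernoulli m i)) (^-monoˡ-≤ (suc i) (n≤1+n m)) ⟩
  m * suc m ^ suc i + suc m ^ suc i
    ≡⟨ +-comm (m * suc m ^ suc i) _ ⟩
  suc m ^ suc (suc i) ∎
  where
  open +-*-Solver
  open ≤-Reasoning

*-^ : ∀ m n i → (m * n) ^ i ≡ m ^ i * n ^ i
*-^ m n zero    = refl
*-^ m n (suc i) rewrite *-^ m n i =
  solve 4 (λ m n p q → m :* n :* (p :* q) := m :* p :* (n :* q)) refl m n (m ^ i) (n ^ i)
  where open +-*-Solver

-- Bernoulli's inequality in the form (1 + 1/N)^N ≥ 2 with N = `suc m`, denominators cleared.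
doubling : ∀ m → 2 * suc m ^ suc m ≤ suc (suc m) ^ suc m
doubling m = ≤-trans (≤-reflexive (cong (suc m ^ suc m +_) (+-identityʳ _))) (bernoulli (suc m) m)

module _ (G : Multigraph) where
  open Multigraph G

  darts-unique : Unique (darts G)
  darts-unique = cartesianProduct⁺ (allFin⁺ #E) (((λ ()) ∷ []) ∷ ([] ∷ []))

  ∈-darts : ∀ h → h ∈ darts G
  ∈-darts (e , false) = ∈-cartesianProduct⁺ (∈-allFin e) (here refl)
  ∈-darts (e , true)  = ∈-cartesianProduct⁺ (∈-allFin e) (there (here refl))

  _≟ᵈ_ : DecidableEquality (Dart G)
  _≟ᵈ_ = Product.≡-dec _≟_ Bool._≟_

  ∃dart? : ∀ {P : Pred (Dart G) 0ℓ} → Decidable P → Dec (∃ P)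
  ∃dart? P? = map′ (λ { (e , inj₁ p) → _ , p ; (e , inj₂ p) → _ , p })
                   (λ { ((e , false) , p) → e , inj₁ p ; ((e , true) , p) → e , inj₂ p })
                   (any? λ e → P? (e , false) ⊎-dec P? (e , true))

  ∀dart? : ∀ {P : Pred (Dart G) 0ℓ} → Decidable P → Dec (∀ h → P h)
  ∀dart? P? = map′ (λ { f (e , false) → proj₁ (f e) ; f (e , true) → proj₂ (f e) })
                   (λ f e → f (e , false) , f (e , true))
                   (all? λ e → P? (e , false) ×-dec P? (e , true))

  Labelling : Set
  Labelling = Dart G → Bool

  Owned : Labelling → Vertex G → Pred (Dart G) 0ℓ
  Owned ℓ v h = tail G h ≡ v × ℓ h ≡ true

  owned? : ∀ ℓ v → Decidable (Owned ℓ v)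
  owned? ℓ v h = (tail G h ≟ v) ×-dec (ℓ h Bool.≟ true)

  outdegree-∑ : ∀ ℓ v → outdegree G ℓ v ≡ ∑ (darts G) (λ h → 𝟙 (owned? ℓ v h))
  outdegree-∑ ℓ v = length-filter (owned? ℓ v) (darts G)

  Oriented : Labelling → Pred (Dart G) 0ℓ
  Oriented ℓ h = ℓ h ≡ true ⊎ ℓ (reverse G h) ≡ true

  -- The sides of the edge are compared, not their vertices, so that a loop gets exactly one owned
  -- half like any other edge.
  own : Labelling → Dart G → Labelling
  own ℓ h g with proj₁ g ≟ proj₁ h
  ... | yes _ = does (proj₂ g Bool.≟ proj₂ h)
  ... | no  _ = ℓ g

  own-self : ∀ ℓ h → own ℓ h h ≡ true
  own-self ℓ (e , s) with e ≟ e
  ... | no  ≢ = ⊥-elim (≢ refl)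
  ... | yes _ with s
  ...   | false = refl
  ...   | true  = refl

  own-reverse : ∀ ℓ h → own ℓ h (reverse G h) ≡ false
  own-reverse ℓ (e , s) with e ≟ e
  ... | no  ≢ = ⊥-elim (≢ refl)
  ... | yes _ with s
  ...   | false = refl
  ...   | true  = refl

  own-other : ∀ ℓ h g → edge G g ≢ edge G h → own ℓ h g ≡ ℓ g
  own-other ℓ h g ≢ with proj₁ g ≟ proj₁ h
  ... | yes eq = ⊥-elim (≢ eq)
  ... | no  _  = refl

  own-cases : ∀ ℓ h g → own ℓ h g ≡ true → g ≡ h ⊎ (ℓ g ≡ true × g ≢ reverse G h)
  own-cases ℓ h g t = split (edge G g ≟ edge G h)
    where
    split : Dec (edge G g ≡ edge G h) → g ≡ h ⊎ (ℓ g ≡ true × g ≢ reverse G h)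
    split (no ≢) = inj₂ (trans (sym (own-other ℓ h g ≢)) t , λ { refl → ≢ refl })
    split (yes eq) with same-edge G h g (sym eq)
    ... | inj₁ refl = inj₁ refl
    ... | inj₂ refl = ⊥-elim (false≢true (trans (sym (own-reverse ℓ h)) t))

  module _ (ℓ : Labelling) (h : Dart G) where

    outdegree-own≤suc : ∀ x → outdegree G (own ℓ h) x ≤ suc (outdegree G ℓ x)
    outdegree-own≤suc x = begin
      outdegree G (own ℓ h) x
        ≡⟨ outdegree-∑ (own ℓ h) x ⟩
      ∑ (darts G) (λ g → 𝟙 (owned? (own ℓ h) x g))
        ≤⟨ ∑-mono (darts G) (λ g → 𝟙≤ (owned? (own ℓ h) x g) (bound g)) ⟩
      ∑ (darts G) (λ g → 𝟙 (g ≟ᵈ h) + 𝟙 (owned? ℓ x g))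
        ≡⟨ ∑-+ (darts G) (λ g → 𝟙 (g ≟ᵈ h)) _ ⟩
      ∑ (darts G) (λ g → 𝟙 (g ≟ᵈ h)) + ∑ (darts G) (λ g → 𝟙 (owned? ℓ x g))
        ≤⟨ +-mono-≤ (∑-atMostOne darts-unique (_≟ᵈ h) (λ _ _ p q → trans p (sym q)))
                    (≤-reflexive (sym (outdegree-∑ ℓ x))) ⟩
      suc (outdegree G ℓ x) ∎
      where
      open ≤-Reasoning
      bound : ∀ g → Owned (own ℓ h) x g → 1 ≤ 𝟙 (g ≟ᵈ h) + 𝟙 (owned? ℓ x g)
      bound g (t , o) with own-cases ℓ h g o
      ... | inj₁ g≡h = ≤-trans (≤-reflexive (sym (𝟙-yes (g ≟ᵈ h) g≡h))) (m≤m+n _ _)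
      ... | inj₂ (o′ , _) = ≤-trans (≤-reflexive (sym (𝟙-yes (owned? ℓ x g) (t , o′)))) (m≤n+m _ _)

    outdegree-own≤ : ∀ x → tail G h ≢ x → outdegree G (own ℓ h) x ≤ outdegree G ℓ x
    outdegree-own≤ x ≢x = begin
      outdegree G (own ℓ h) x                      ≡⟨ outdegree-∑ (own ℓ h) x ⟩
      ∑ (darts G) (λ g → 𝟙 (owned? (own ℓ h) x g)) ≤⟨ ∑-mono (darts G) (λ g → 𝟙-mono (owned? (own ℓ h) x g) (owned? ℓ x g) (keep g)) ⟩
      ∑ (darts G) (λ g → 𝟙 (owned? ℓ x g))         ≡⟨ outdegree-∑ ℓ x ⟨
      outdegree G ℓ x                              ∎
      where
      open ≤-Reasoning
      keep : ∀ g → Owned (own ℓ h) x g → Owned ℓ x g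
      keep g (t , o) with own-cases ℓ h g o
      ... | inj₁ refl = ⊥-elim (≢x t)
      ... | inj₂ (o′ , _) = t , o′

    outdegree-own< : ∀ x → head G h ≡ x → tail G h ≢ x → ℓ (reverse G h) ≡ true →
                     outdegree G (own ℓ h) x < outdegree G ℓ x
    outdegree-own< x h≡x ≢x rev = begin
      suc (outdegree G (own ℓ h) x)
        ≡⟨ cong suc (outdegree-∑ (own ℓ h) x) ⟩
      1 + ∑ (darts G) (λ g → 𝟙 (owned? (own ℓ h) x g))
        ≤⟨ +-monoˡ-≤ _ (≤-trans (≤-reflexive (sym (𝟙-yes (reverse G h ≟ᵈ reverse G h) refl)))
                                (∑-∈ (λ g → 𝟙 (g ≟ᵈ reverse G h)) (∈-darts (reverse G h)))) ⟩
      ∑ (darts G) (λ g → 𝟙 (g ≟ᵈ reverse G h)) + ∑ (darts G) (λ g → 𝟙 (owned? (own ℓ h) x g))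
        ≡⟨ ∑-+ (darts G) (λ g → 𝟙 (g ≟ᵈ reverse G h)) _ ⟨
      ∑ (darts G) (λ g → 𝟙 (g ≟ᵈ reverse G h) + 𝟙 (owned? (own ℓ h) x g))
        ≤⟨ ∑-mono (darts G) bound ⟩
      ∑ (darts G) (λ g → 𝟙 (owned? ℓ x g))
        ≡⟨ outdegree-∑ ℓ x ⟨
      outdegree G ℓ x ∎
      where
      open ≤-Reasoning
      bound : ∀ g → 𝟙 (g ≟ᵈ reverse G h) + 𝟙 (owned? (own ℓ h) x g) ≤ 𝟙 (owned? ℓ x g)
      bound g with g ≟ᵈ reverse G h
      ... | yes refl rewrite 𝟙-yes (owned? ℓ x g) (h≡x , rev)
                           | 𝟙-no (owned? (own ℓ h) x g) (λ (_ , o) → false≢true (trans (sym (own-reverse ℓ h)) o))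
                     = ≤-refl
      ... | no _ = 𝟙-mono (owned? (own ℓ h) x g) (owned? ℓ x g) keep
        where
        keep : Owned (own ℓ h) x g → Owned ℓ x g
        keep (t , o) with own-cases ℓ h g o
        ... | inj₁ refl = ⊥-elim (≢x t)
        ... | inj₂ (o′ , _) = t , o′

  module _ (k : ℕ) where

    record Partial (ℓ : Labelling) : Set where
      field
        exclusive : ∀ h → ℓ h ≡ true → ℓ (reverse G h) ≢ true
        bounded   : ∀ v → outdegree G ℓ v ≤ k

    own-exclusive : ∀ {ℓ} → (∀ h → ℓ h ≡ true → ℓ (reverse G h) ≢ true) →
                    ∀ h g → own ℓ h g ≡ true → own ℓ h (reverse G g) ≢ true
    own-exclusive {ℓ} ex h g o o′ with own-cases ℓ h g o | own-cases ℓ h (reverse G g) o′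
    ... | inj₁ refl | _ = false≢true (trans (sym (own-reverse ℓ h)) o′)
    ... | inj₂ (_ , g≢) | inj₁ eq = g≢ (trans (sym (reverse-reverse G g)) (cong (reverse G) eq))
    ... | inj₂ (t , _)  | inj₂ (t′ , _) = ex g t t′

    own-keeps : ∀ {ℓ} h g → Oriented ℓ g → Oriented (own ℓ h) g
    own-keeps {ℓ} h g o = split (edge G g ≟ edge G h)
      where
      split : Dec (edge G g ≡ edge G h) → Oriented (own ℓ h) g
      split (no ≢) = Sum.map (trans (own-other ℓ h g ≢)) (trans (own-other ℓ h (reverse G g) ≢)) o
      split (yes eq) with same-edge G h g (sym eq)
      ... | inj₁ refl = inj₁ (own-self ℓ h)
      ... | inj₂ refl = inj₂ (trans (cong (own ℓ h) (reverse-reverse G h)) (own-self ℓ h))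

    module _ {T : Pred (Vertex G) 0ℓ} (T? : Decidable T) where

      -- Containment of the `i`-ball of a vertex in `T`. Recursion along darts, instead of a
      -- distance, can be repeated on the table of a cluster, see `Closedᶜ`.
      Closed : ℕ → Vertex G → Set
      Closed zero    v = T v
      Closed (suc i) v = T v × (∀ h → tail G h ≡ v → Closed i (head G h))

      Closed? : ∀ i → Decidable (Closed i)
      Closed? zero    v = T? v
      Closed? (suc i) v = T? v ×-dec ∀dart? (λ h → (tail G h ≟ v) →-dec Closed? i (head G h))

      Closed⇒T : ∀ i {v} → Closed i v → T v
      Closed⇒T zero    c = c
      Closed⇒T (suc i) c = proj₁ c

      Closed-pred : ∀ i {v} → Closed (suc i) v → Closed i v
      Closed-pred zero    (t , _) = t
      Closed-pred (suc i) (t , c) = t , λ h eq → Closed-pred i (c h eq)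

      -- `keeps` leaves room for reversing an oriented edge, as augmentation does.
      record Extends (ℓ ℓ′ : Labelling) : Set where
        field
          keeps : ∀ h → Oriented ℓ h → Oriented ℓ′ h
          local : ∀ h → ¬ (T (tail G h) × T (head G h)) → ℓ′ h ≡ ℓ h

      open Partial
      open Extends

      Extends-refl : ∀ {ℓ} → Extends ℓ ℓ
      Extends-refl = record { keeps = λ _ o → o ; local = λ _ _ → refl }

      Extends-trans : ∀ {ℓ ℓ′ ℓ″} → Extends ℓ ℓ′ → Extends ℓ′ ℓ″ → Extends ℓ ℓ″
      Extends-trans x y = record
        { keeps = λ h o → keeps y h (keeps x h o)
        ; local = λ h ∉T → trans (local y h ∉T) (local x h ∉T) }

      own-extends : ∀ {ℓ} h → T (tail G h) → T (head G h) → Extends ℓ (own ℓ h)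
      own-extends {ℓ} h t t′ = record { keeps = own-keeps h ; local = outside }
        where
        outside : ∀ g → ¬ (T (tail G g) × T (head G g)) → own ℓ h g ≡ ℓ g
        outside g ∉T = own-other ℓ h g λ eq → ∉T (inside (same-edge G h g (sym eq)))
          where
          inside : g ≡ h ⊎ g ≡ reverse G h → T (tail G g) × T (head G g)
          inside (inj₁ refl) = t , t′
          inside (inj₂ refl) = t′ , subst T (cong (tail G) (sym (reverse-reverse G h))) t

      module _ (ℓ : Labelling) where

        Reach : ℕ → Vertex G → Set
        Reach zero    v = outdegree G ℓ v < k
        Reach (suc i) v = Reach i v ⊎ (∃[ h ] Owned ℓ v h × Reach i (head G h))

        Reach? : ∀ i → Decidable (Reach i)
        Reach? zero    v = outdegree G ℓ v <? k
        Reach? (suc i) v = Reach? i v ⊎-dec ∃dart? (λ h → owned? ℓ v h ×-dec Reach? i (head G h))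

        Reach-mono : ∀ {i j v} → i ≤ j → Reach i v → Reach j v
        Reach-mono {j = zero}  z≤n r = r
        Reach-mono {zero} {suc j}  z≤n r = inj₁ (Reach-mono {j = j} z≤n r)
        Reach-mono {suc i} {suc j} (s≤s le) (inj₁ r) = inj₁ (Reach-mono le r)
        Reach-mono {suc i} {suc j} (s≤s le) (inj₂ (h , o , r)) = inj₂ (h , o , Reach-mono le r)

        -- A dart owned by a vertex at distance exactly i + 1 from the free
        -- vertices survives the changes made for the vertices at distance i;
        -- this is the purpose of the last component.
        free : Partial ℓ → ∀ i v → Closed i v → Reach i v →
               ∃[ ℓ′ ] Partial ℓ′ × Extends ℓ ℓ′ × outdegree G ℓ′ v < k ×
                       (∀ h → ℓ h ≡ true → ¬ Reach i (tail G h) → ℓ′ h ≡ true)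
        free p zero v c r = ℓ , p , Extends-refl , r , λ _ o _ → o
        free p (suc i) v c r with Reach? i v
        ... | yes r′ with ℓ′ , p′ , x , f , s ← free p i v (Closed-pred i c) r′ =
              ℓ′ , p′ , x , f , λ h o ¬r → s h o (¬r ∘ inj₁)
        ... | no ¬r with r
        ...   | inj₁ r′ = ⊥-elim (¬r r′)
        -- The head of `h` is freed first and then takes over the edge, which uses up the room made
        -- there and makes room at the tail. As the tail is not in `Reach i`, the last component
        -- guarantees that it still owns `h` at that moment.
        ...   | inj₂ (h , (refl , o) , r′)
                with ℓ′ , p′ , x , f , s ← free p i (head G h) (proj₂ c h refl) r′ =
                own ℓ′ (reverse G h) , p″ ,
                Extends-trans x (own-extends (reverse G h) (Closed⇒T i (proj₂ c h refl))
                                  (subst (T ∘ tail G) (sym (reverse-reverse G h)) (proj₁ c))) ,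
                f″ , s″
          where
          rr = reverse-reverse G h
          apart : head G h ≢ tail G h
          apart eq = ¬r (subst (Reach i) eq r′)
          f″ : outdegree G (own ℓ′ (reverse G h)) (tail G h) < k
          f″ = <-≤-trans (outdegree-own< ℓ′ (reverse G h) (tail G h) (cong (tail G) rr) apart
                           (trans (cong ℓ′ rr) (s h o ¬r)))
                         (bounded p′ (tail G h))
          bounded″ : ∀ w → outdegree G (own ℓ′ (reverse G h)) w ≤ k
          bounded″ w with head G h ≟ w
          ... | yes refl = ≤-trans (outdegree-own≤suc ℓ′ (reverse G h) w) f
          ... | no ≢w    = ≤-trans (outdegree-own≤ ℓ′ (reverse G h) w ≢w) (bounded p′ w)
          p″ : Partial (own ℓ′ (reverse G h))
          p″ = record { exclusive = own-exclusive (exclusive p′) (reverse G h) ; bounded = bounded″ }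
          s″ : ∀ g → ℓ g ≡ true → ¬ Reach (suc i) (tail G g) → own ℓ′ (reverse G h) g ≡ true
          s″ g og ¬rg = trans (own-other ℓ′ (reverse G h) g other) (s g og (¬rg ∘ inj₁))
            where
            other : edge G g ≢ edge G h
            other eq with same-edge G h g (sym eq)
            ... | inj₁ refl = ¬rg (inj₂ (h , (refl , o) , r′))
            ... | inj₂ refl = ¬rg (inj₁ r′)

        module _ (v : Vertex G) where

          Layer : ℕ → Vertex G → Set
          Layer zero    x = x ≡ v
          Layer (suc i) x = Layer i x ⊎ (∃[ h ] (ℓ h ≡ true × head G h ≡ x) × Layer i (tail G h))

          Layer? : ∀ i → Decidable (Layer i)
          Layer? zero    x = x ≟ v
          Layer? (suc i) x = Layer? i x ⊎-dec
            ∃dart? (λ h → ((ℓ h Bool.≟ true) ×-dec (head G h ≟ x)) ×-dec Layer? i (tail G h))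

          Layer-Reach : ∀ i {j x} → Layer i x → Reach j x → Reach (i + j) v
          Layer-Reach zero    refl r = r
          Layer-Reach (suc i) (inj₁ l) r = inj₁ (Layer-Reach i l r)
          Layer-Reach (suc i) {j} (inj₂ (h , (o , refl) , l)) r =
            subst (λ n → Reach n v) (+-suc i j) (Layer-Reach i {suc j} l (inj₂ (h , (refl , o) , r)))

          ∣Layer∣ : ℕ → ℕ
          ∣Layer∣ i = ∑ (allFin #V) (λ x → 𝟙 (Layer? i x))

          module _ (p : Partial ℓ) {a : ℕ} (parts : PartitionsIntoPseudoForests G a) where

            -- The darts owned by vertices of layer i belong to different edges, since `exclusive`
            -- forbids owning an edge from both sides, and these edges lie inside layer i + 1, where
            -- `density` limits their number.
            layer-growth : ∀ i → (∀ x → Layer i x → k ≤ outdegree G ℓ x) → ∣Layer∣ i * k ≤ a * ∣Layer∣ (suc i)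
            layer-growth i full = begin
              ∣Layer∣ i * k
                ≡⟨ ∑-*ʳ (allFin #V) k _ ⟨
              ∑ (allFin #V) (λ x → 𝟙 (Layer? i x) * k)
                ≤⟨ ∑-mono (allFin #V) saturated ⟩
              ∑ (allFin #V) (λ x → ∑ (darts G) (λ h → 𝟙 (from? x h)))
                ≡⟨ ∑-swap (allFin #V) (darts G) (λ x h → 𝟙 (from? x h)) ⟩
              ∑ (darts G) (λ h → ∑ (allFin #V) (λ x → 𝟙 (from? x h)))
                ≡⟨ ∑-product _,_ (allFin #E) (false ∷ true ∷ []) _ ⟩
              ∑ (allFin #E) (λ e → ∑ (false ∷ true ∷ []) (λ s → ∑ (allFin #V) (λ x → 𝟙 (from? x (e , s)))))
                ≤⟨ ∑-mono (allFin #E) once ⟩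
              ∑ (allFin #E) (λ e → 𝟙 (Inside? G (Layer? (suc i)) e))
                ≤⟨ density G (Layer? (suc i)) parts ⟩
              a * ∣Layer∣ (suc i) ∎
              where
              open ≤-Reasoning
              from? : ∀ x h → Dec (Layer i x × Owned ℓ x h)
              from? x h = Layer? i x ×-dec owned? ℓ x h
              saturated : ∀ x → 𝟙 (Layer? i x) * k ≤ ∑ (darts G) (λ h → 𝟙 (from? x h))
              saturated x with Layer? i x
              ... | no _ = z≤n
              ... | yes l = begin
                k + 0                                ≡⟨ +-identityʳ k ⟩
                k                                    ≤⟨ full x l ⟩
                outdegree G ℓ x                      ≡⟨ outdegree-∑ ℓ x ⟩
                ∑ (darts G) (λ h → 𝟙 (owned? ℓ x h)) ∎
              tails : Dart G → ℕ
              tails h = ∑ (allFin #V) (λ x → 𝟙 (from? x h))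
              tails≤1 : ∀ h → tails h ≤ 1
              tails≤1 h = ∑-atMostOne (allFin⁺ #V) (λ x → from? x h) (λ _ _ (_ , eq , _) (_ , eq′ , _) → trans (sym eq) eq′)
              tails≡0 : ∀ h → ¬ (Layer i (tail G h) × ℓ h ≡ true) → tails h ≡ 0
              tails≡0 h ¬l = ∑-none (allFin #V) (λ x → from? x h)
                               (All.tabulate λ { _ (l , refl , o) → ¬l (l , o) })
              into : ∀ h → Layer i (tail G h) → ℓ h ≡ true → Layer (suc i) (tail G h) × Layer (suc i) (head G h)
              into h l o = inj₁ l , inj₂ (h , (o , refl) , l)
              once : ∀ e → tails (e , false) + (tails (e , true) + 0) ≤ 𝟙 (Inside? G (Layer? (suc i)) e)
              once e with Layer? i (tail G (e , false)) ×-dec (ℓ (e , false) Bool.≟ true)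
                        | Layer? i (tail G (e , true)) ×-dec (ℓ (e , true) Bool.≟ true)
              ... | yes (_ , o) | yes (_ , o′) = ⊥-elim (exclusive p (e , false) o o′)
              ... | yes (l , o) | no ¬l
                    rewrite 𝟙-yes (Inside? G (Layer? (suc i)) e) (into (e , false) l o) | tails≡0 (e , true) ¬l =
                      ≤-trans (≤-reflexive (+-identityʳ _)) (tails≤1 (e , false))
              ... | no ¬l | yes (l , o)
                    rewrite 𝟙-yes (Inside? G (Layer? (suc i)) e) (swap (into (e , true) l o)) | tails≡0 (e , false) ¬l =
                      ≤-trans (≤-reflexive (+-identityʳ _)) (tails≤1 (e , true))
              ... | no ¬l | no ¬l′ rewrite tails≡0 (e , false) ¬l | tails≡0 (e , true) ¬l′ = z≤n

            module _ {m : ℕ} (a≤k : a * suc (suc m) ≤ k * suc m) (0<a : 0 < a) where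

              -- `a≤k` says that k ≥ a (1 + 1/(m+1)), so by `layer-growth` each step multiplies the
              -- size by at least (m+2)/(m+1).
              layers-grow : ∀ i → (∀ j x → j < i → Layer j x → k ≤ outdegree G ℓ x) →
                            suc (suc m) ^ i ≤ suc m ^ i * ∣Layer∣ i
              layers-grow zero full = ≤-trans (≤-reflexive (sym (𝟙-yes (Layer? 0 v) refl)))
                (≤-trans (∑-∈ (λ x → 𝟙 (Layer? 0 x)) (∈-allFin v)) (≤-reflexive (sym (+-identityʳ _))))
              layers-grow (suc i) full =
                *-cancelˡ-≤ a {{>-nonZero 0<a}} (begin
                  a * (M * M ^ i)            ≡⟨ *-assoc a M (M ^ i) ⟨
                  a * M * M ^ i              ≤⟨ *-mono-≤ a≤k (layers-grow i (λ j x lt → full j x (m<n⇒m<1+n lt))) ⟩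
                  k * N * (N ^ i * L)        ≡⟨ solve 4 (λ k N p L → k :* N :* (p :* L) := N :* p :* (L :* k)) refl k N (N ^ i) L ⟩
                  N * N ^ i * (L * k)        ≤⟨ *-monoʳ-≤ (N * N ^ i) (layer-growth i (λ x → full i x (n<1+n i))) ⟩
                  N * N ^ i * (a * L′)       ≡⟨ solve 4 (λ N p a L → N :* p :* (a :* L) := a :* (N :* p :* L)) refl N (N ^ i) a L′ ⟩
                  a * (N * N ^ i * L′)       ∎)
                where
                open ≤-Reasoning
                open +-*-Solver
                M  = suc (suc m)
                N  = suc m
                L  = ∣Layer∣ i
                L′ = ∣Layer∣ (suc i)

              -- With no free vertex in reach all these layers are saturated. By `doubling` they
              -- double every m + 1 steps and outgrow the graph after `J` doublings.
              free-vertex-near : ∀ J → #V < 2 ^ J → Reach (suc m * J) v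
              free-vertex-near J V< with Reach? (suc m * J) v
              ... | yes r = r
              ... | no ¬r = ⊥-elim (<⇒≱ V< (≤-trans large small))
                where
                open ≤-Reasoning
                full : ∀ j x → j < suc m * J → Layer j x → k ≤ outdegree G ℓ x
                full j x lt l = ≮⇒≥ λ r →
                  ¬r (Reach-mono (<⇒≤ lt) (subst (λ n → Reach n v) (+-identityʳ j) (Layer-Reach j {0} l r)))
                small : ∣Layer∣ (suc m * J) ≤ #V
                small = begin
                  ∣Layer∣ (suc m * J)          ≤⟨ ∑-mono (allFin #V) (λ x → 𝟙≤ (Layer? (suc m * J) x) (λ _ → ≤-refl)) ⟩
                  ∑ (allFin #V) (λ _ → 1)      ≡⟨ ∑-const (allFin #V) 1 ⟩
                  length (allFin #V) * 1       ≡⟨ *-identityʳ _ ⟩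
                  length (allFin #V)           ≡⟨ List.length-tabulate {n = #V} id ⟩
                  #V                           ∎
                large : 2 ^ J ≤ ∣Layer∣ (suc m * J)
                large = *-cancelˡ-≤ (suc m ^ (suc m * J)) {{m^n≢0 (suc m) (suc m * J)}} (begin
                  suc m ^ (suc m * J) * 2 ^ J    ≡⟨ cong (_* 2 ^ J) (^-*-assoc (suc m) (suc m) J) ⟨
                  (suc m ^ suc m) ^ J * 2 ^ J    ≡⟨ *-comm ((suc m ^ suc m) ^ J) (2 ^ J) ⟩
                  2 ^ J * (suc m ^ suc m) ^ J    ≡⟨ *-^ 2 (suc m ^ suc m) J ⟨
                  (2 * suc m ^ suc m) ^ J        ≤⟨ ^-monoˡ-≤ J (doubling m) ⟩
                  (suc (suc m) ^ suc m) ^ J      ≡⟨ ^-*-assoc (suc (suc m)) (suc m) J ⟩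
                  suc (suc m) ^ (suc m * J)      ≤⟨ layers-grow (suc m * J) full ⟩
                  suc m ^ (suc m * J) * ∣Layer∣ (suc m * J) ∎)

      module _ {a : ℕ} (parts : PartitionsIntoPseudoForests G a)
               {m : ℕ} (a≤k : a * suc (suc m) ≤ k * suc m) (J : ℕ) (V< : #V < 2 ^ J) where

        orient : ∀ {ℓ} → Partial ℓ → ∀ h → Closed (suc (suc m * J)) (tail G h) →
                 ∃[ ℓ′ ] Partial ℓ′ × Extends ℓ ℓ′ × Oriented ℓ′ h
        orient {ℓ} p h c
          with ℓ′ , p′ , x , f , _ ← free ℓ p (suc m * J) (tail G h) (Closed-pred (suc m * J) c)
                 -- The class of the edge of `h` is an element of `Fin a`, whence `a` is positive.
                 (free-vertex-near ℓ (tail G h) p parts a≤k (Fin⇒0< (proj₁ parts (edge G h))) J V<)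
          = own ℓ′ h ,
            record { exclusive = own-exclusive (exclusive p′) h ; bounded = bounded′ } ,
            Extends-trans x (own-extends h (proj₁ c) (Closed⇒T (suc m * J) (proj₂ c h refl))) ,
            inj₁ (own-self ℓ′ h)
          where
          bounded′ : ∀ w → outdegree G (own ℓ′ h) w ≤ k
          bounded′ w with tail G h ≟ w
          ... | yes refl = ≤-trans (outdegree-own≤suc ℓ′ h w) f
          ... | no ≢w    = ≤-trans (outdegree-own≤ ℓ′ h w ≢w) (bounded p′ w)

        orient-list : ∀ {ℓ} → Partial ℓ → ∀ hs →
                      ∃[ ℓ′ ] Partial ℓ′ × Extends ℓ ℓ′ ×
                              (∀ h → h ∈ hs → Closed (suc (suc m * J)) (tail G h) → Oriented ℓ′ h)
        orient-list {ℓ} p [] = ℓ , p , Extends-refl , λ _ ()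
        orient-list p (h ∷ hs) with ℓ′ , p′ , x , o ← orient-list p hs
          with Closed? (suc (suc m * J)) (tail G h)
        ... | no ¬c = ℓ′ , p′ , x , λ { _ (here refl) c → ⊥-elim (¬c c) ; g (there g∈) c → o g g∈ c }
        ... | yes c with ℓ″ , p″ , x′ , o′ ← orient p′ h c =
          ℓ″ , p″ , Extends-trans x x′ ,
          λ { _ (here refl) _ → o′ ; g (there g∈) c′ → keeps x′ g (o g g∈ c′) }

        orient-closed : ∀ {ℓ} → Partial ℓ →
                        ∃[ ℓ′ ] Partial ℓ′ × Extends ℓ ℓ′ ×
                                (∀ h → Closed (suc (suc m * J)) (tail G h) → Oriented ℓ′ h)
        orient-closed p with ℓ′ , p′ , x , o ← orient-list p (darts G) =
          ℓ′ , p′ , x , λ h → o h (∈-darts h)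

-- Random radii

bits : ∀ B → List (Vec Bool B)
bits = allVecs (false ∷ true ∷ [])

∑-allVecs : {A : Set} (xs : List A) (n : ℕ) (f : Vec A (suc n) → ℕ) →
            ∑ (allVecs xs (suc n)) f ≡ ∑ xs (λ x → ∑ (allVecs xs n) (λ v → f (x ∷ v)))
∑-allVecs xs n f = ∑-product Vec._∷_ xs (allVecs xs n) f

length-∑ : {A : Set} (xs : List A) → length xs ≡ ∑ xs (λ _ → 1)
length-∑ xs = sym (trans (∑-const xs 1) (*-identityʳ (length xs)))

length-allVecs : {A : Set} (xs : List A) (n : ℕ) → length (allVecs xs n) ≡ length xs ^ n
length-allVecs xs zero    = refl
length-allVecs xs (suc n) = begin
  length (allVecs xs (suc n))                   ≡⟨ length-∑ (allVecs xs (suc n)) ⟩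
  ∑ (allVecs xs (suc n)) (λ _ → 1)              ≡⟨ ∑-allVecs xs n (λ _ → 1) ⟩
  ∑ xs (λ _ → ∑ (allVecs xs n) (λ _ → 1))       ≡⟨ ∑-const xs _ ⟩
  length xs * ∑ (allVecs xs n) (λ _ → 1)        ≡⟨ cong (length xs *_) (length-∑ (allVecs xs n)) ⟨
  length xs * length (allVecs xs n)             ≡⟨ cong (length xs *_) (length-allVecs xs n) ⟩
  length xs ^ suc n                             ∎
  where open ≡-Reasoning

-- Exchanging the order of summation reduces the comparison to a single redrawn coordinate. This is
-- how conditioning on the radii of all other vertices is expressed.
resample : {A : Set} (xs : List A) {n : ℕ} (y : Fin n) (f g : Vec A n → ℕ) →
           (∀ ω → ∑ xs (λ x → f (ω [ y ]≔ x)) ≤ ∑ xs (λ x → g (ω [ y ]≔ x))) →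
           ∑ (allVecs xs n) f ≤ ∑ (allVecs xs n) g
resample [] {suc n} y f g h = z≤n
resample xs@(x₀ ∷ _) {suc n} zero f g h = begin
  ∑ (allVecs xs (suc n)) f                        ≡⟨ ∑-allVecs xs n f ⟩
  ∑ xs (λ x → ∑ (allVecs xs n) (λ v → f (x ∷ v))) ≡⟨ ∑-swap xs (allVecs xs n) (λ x v → f (x ∷ v)) ⟩
  -- `x₀` is a placeholder, overwritten by the update at `zero`.
  ∑ (allVecs xs n) (λ v → ∑ xs (λ x → f (x ∷ v))) ≤⟨ ∑-mono (allVecs xs n) (λ v → h (x₀ ∷ v)) ⟩
  ∑ (allVecs xs n) (λ v → ∑ xs (λ x → g (x ∷ v))) ≡⟨ ∑-swap xs (allVecs xs n) (λ x v → g (x ∷ v)) ⟨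
  ∑ xs (λ x → ∑ (allVecs xs n) (λ v → g (x ∷ v))) ≡⟨ ∑-allVecs xs n g ⟨
  ∑ (allVecs xs (suc n)) g                        ∎
  where open ≤-Reasoning
resample xs@(_ ∷ _) {suc n} (suc y) f g h = begin
  ∑ (allVecs xs (suc n)) f                        ≡⟨ ∑-allVecs xs n f ⟩
  ∑ xs (λ x → ∑ (allVecs xs n) (λ v → f (x ∷ v))) ≤⟨ ∑-mono xs (λ x → resample xs y _ _ (λ ω → h (x ∷ ω))) ⟩
  ∑ xs (λ x → ∑ (allVecs xs n) (λ v → g (x ∷ v))) ≡⟨ ∑-allVecs xs n g ⟨
  ∑ (allVecs xs (suc n)) g                        ∎
  where open ≤-Reasoning

∑-split-bits : ∀ B b (f : Vec Bool B → Vec Bool b → ℕ) →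
               ∑ (bits (B + b)) (λ x → f (Vec.take B x) (Vec.drop B x)) ≡ ∑ (bits B) (λ x → ∑ (bits b) (f x))
∑-split-bits zero    b f = sym (+-identityʳ _)
∑-split-bits (suc B) b f = begin
  ∑ (bits (suc B + b)) (λ x → f (Vec.take (suc B) x) (Vec.drop (suc B) x))
    ≡⟨ ∑-allVecs (false ∷ true ∷ []) (B + b) _ ⟩
  ∑ (false ∷ true ∷ []) (λ s → ∑ (bits (B + b)) (λ x → f (s ∷ Vec.take B x) (Vec.drop B x)))
    ≡⟨ ∑-cong (false ∷ true ∷ []) (λ s → ∑-split-bits B b (λ x → f (s ∷ x))) ⟩
  ∑ (false ∷ true ∷ []) (λ s → ∑ (bits B) (λ x → ∑ (bits b) (f (s ∷ x))))
    ≡⟨ ∑-allVecs (false ∷ true ∷ []) B _ ⟨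
  ∑ (bits (suc B)) (λ x → ∑ (bits b) (f x)) ∎
  where open ≡-Reasoning

∑-split : ∀ B b n (f : Vec (Vec Bool B) n → Vec (Vec Bool b) n → ℕ) →
          ∑ (allVecs (bits (B + b)) n) (λ ω → f (Vec.map (Vec.take B) ω) (Vec.map (Vec.drop B) ω)) ≡
          ∑ (allVecs (bits B) n) (λ ω → ∑ (allVecs (bits b) n) (f ω))
∑-split B b zero    f = sym (+-identityʳ _)
∑-split B b (suc n) f = begin
  ∑ (allVecs (bits (B + b)) (suc n)) (λ ω → f (Vec.map (Vec.take B) ω) (Vec.map (Vec.drop B) ω))
    ≡⟨ ∑-allVecs (bits (B + b)) n _ ⟩
  ∑ (bits (B + b)) (λ x → ∑ (allVecs (bits (B + b)) n)
    (λ ω → f (Vec.take B x ∷ Vec.map (Vec.take B) ω) (Vec.drop B x ∷ Vec.map (Vec.drop B) ω)))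
    ≡⟨ ∑-cong (bits (B + b)) (λ x → ∑-split B b n (λ ω₁ ω₂ → f (Vec.take B x ∷ ω₁) (Vec.drop B x ∷ ω₂))) ⟩
  ∑ (bits (B + b)) (λ x → ∑ (allVecs (bits B) n) (λ ω₁ → ∑ (allVecs (bits b) n)
    (λ ω₂ → f (Vec.take B x ∷ ω₁) (Vec.drop B x ∷ ω₂))))
    ≡⟨ ∑-split-bits B b (λ x₁ x₂ → ∑ (allVecs (bits B) n) (λ ω₁ → ∑ (allVecs (bits b) n)
         (λ ω₂ → f (x₁ ∷ ω₁) (x₂ ∷ ω₂)))) ⟩
  ∑ (bits B) (λ x₁ → ∑ (bits b) (λ x₂ → ∑ (allVecs (bits B) n) (λ ω₁ → ∑ (allVecs (bits b) n)
    (λ ω₂ → f (x₁ ∷ ω₁) (x₂ ∷ ω₂)))))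
    ≡⟨ ∑-cong (bits B) (λ x₁ → ∑-swap (bits b) (allVecs (bits B) n) _) ⟩
  ∑ (bits B) (λ x₁ → ∑ (allVecs (bits B) n) (λ ω₁ → ∑ (bits b) (λ x₂ → ∑ (allVecs (bits b) n)
    (λ ω₂ → f (x₁ ∷ ω₁) (x₂ ∷ ω₂)))))
    ≡⟨ ∑-cong (bits B) (λ x₁ → ∑-cong (allVecs (bits B) n) (λ ω₁ → ∑-allVecs (bits b) n (f (x₁ ∷ ω₁)))) ⟨
  ∑ (bits B) (λ x₁ → ∑ (allVecs (bits B) n) (λ ω₁ → ∑ (allVecs (bits b) (suc n)) (f (x₁ ∷ ω₁))))
    ≡⟨ ∑-allVecs (bits B) n _ ⟨
  ∑ (allVecs (bits B) (suc n)) (λ ω → ∑ (allVecs (bits b) (suc n)) (f ω)) ∎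
  where open ≡-Reasoning

-- Under uniform bits, Pr[ lead ≥ j ] = 2^-j for all j ≤ B.
lead : ∀ {B} → Vec Bool B → ℕ
lead []           = 0
lead (true ∷ bs)  = suc (lead bs)
lead (false ∷ bs) = 0

Previous : Pred ℕ 0ℓ → Pred ℕ 0ℓ
Previous H zero    = ⊥
Previous H (suc x) = H x

-- For an upward closed `H`, this singles out the threshold.
First : Pred ℕ 0ℓ → Pred ℕ 0ℓ
First H x = H x × ¬ Previous H x

Previous? : ∀ {H} → Decidable H → Decidable (Previous H)
Previous? H? zero    = no λ ()
Previous? H? (suc x) = H? x

First? : ∀ {H} → Decidable H → Decidable (First H)
First? H? x = H? x ×-dec ¬? (Previous? H? x)

-- The geometric distribution is memoryless; the summand 1 accounts for its truncation.
first-hit : ∀ B {H : Pred ℕ 0ℓ} (H? : Decidable H) → (∀ x → H x → H (suc x)) →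
            2 * ∑ (bits B) (λ β → 𝟙 (First? H? (lead β))) ≤ ∑ (bits B) (λ β → 𝟙 (H? (lead β))) + 1
first-hit zero H? mono with H? 0
... | yes _ = ≤-refl
... | no  _ = z≤n
first-hit (suc B) {H} H? mono = subst₂ (λ s t → 2 * s ≤ t + 1)
  (sym (∑-allVecs (false ∷ true ∷ []) B (λ β → 𝟙 (First? H? (lead β)))))
  (sym (∑-allVecs (false ∷ true ∷ []) B (λ β → 𝟙 (H? (lead β)))))
  (split (H? 0))
  where
  open ≤-Reasoning
  open +-*-Solver
  F₀ = ∑ (bits B) (λ _ → 𝟙 (First? H? 0))
  F₁ = ∑ (bits B) (λ β → 𝟙 (First? H? (suc (lead β))))
  H₀ = ∑ (bits B) (λ _ → 𝟙 (H? 0))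
  H₁ = ∑ (bits B) (λ β → 𝟙 (H? (suc (lead β))))
  split : Dec (H 0) → 2 * (F₀ + (F₁ + 0)) ≤ (H₀ + (H₁ + 0)) + 1
  -- Only radius 0 is then the least hit. It is drawn when the first bit is `false`, on half of all
  -- strings.
  split (yes h₀) = begin
    2 * (F₀ + (F₁ + 0)) ≤⟨ *-monoʳ-≤ 2 (+-mono-≤ (∑-mono (bits B) (λ _ → 𝟙-mono (First? H? 0) (H? 0) proj₁))
                                        (+-monoˡ-≤ 0 (≤-trans (∑-mono (bits B) none) (≤-reflexive (trans (∑-const (bits B) 0) (*-zeroʳ (length (bits B)))))))) ⟩
    2 * (H₀ + (0 + 0))  ≡⟨ solve 1 (λ x → con 2 :* (x :+ (con 0 :+ con 0)) := x :+ (x :+ con 0)) refl H₀ ⟩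
    H₀ + (H₀ + 0)       ≤⟨ +-monoʳ-≤ H₀ (+-monoˡ-≤ 0 (∑-mono (bits B) (λ β → 𝟙-mono (H? 0) (H? (suc (lead β))) (λ _ → all (suc (lead β)))))) ⟩
    H₀ + (H₁ + 0)       ≤⟨ m≤m+n _ 1 ⟩
    H₀ + (H₁ + 0) + 1   ∎
    where
    all : ∀ x → H x
    all zero    = h₀
    all (suc x) = mono x (all x)
    none : ∀ β → 𝟙 (First? H? (suc (lead β))) ≤ 0
    none β = ≤-reflexive (𝟙-no (First? H? (suc (lead β))) (λ (_ , ¬h) → ¬h (all (lead β))))
  -- A first bit `false` gives radius 0 and no hit; after `true` the remaining bits face the same
  -- question for `H ∘ suc`. This is memorylessness.
  split (no ¬h₀) = begin
    2 * (F₀ + (F₁ + 0)) ≤⟨ *-monoʳ-≤ 2 (+-mono-≤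
                             (≤-trans (∑-mono (bits B) (λ _ → ≤-reflexive (𝟙-no (First? H? 0) (¬h₀ ∘ proj₁))))
                                      (≤-reflexive (trans (∑-const (bits B) 0) (*-zeroʳ (length (bits B))))))
                             (+-monoˡ-≤ 0 (∑-mono (bits B) (λ β →
                               𝟙-mono (First? H? (suc (lead β))) (First? (H? ∘ suc) (lead β)) (shift (lead β)))))) ⟩
    2 * (0 + (F′ + 0))  ≡⟨ cong (2 *_) (+-identityʳ F′) ⟩
    2 * F′              ≤⟨ first-hit B (H? ∘ suc) (mono ∘ suc) ⟩
    H₁ + 1              ≤⟨ +-monoˡ-≤ 1 (≤-trans (m≤m+n H₁ 0) (m≤n+m (H₁ + 0) H₀)) ⟩
    H₀ + (H₁ + 0) + 1   ∎
    where
    F′ = ∑ (bits B) (λ β → 𝟙 (First? (H? ∘ suc) (lead β)))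
    shift : ∀ x → First H (suc x) → First (H ∘ suc) x
    shift zero    (h , _)  = h , λ ()
    shift (suc x) (h , ¬p) = h , ¬p

-- The first vertex, in the order of the keys, whose radius reaches its threshold

module _ {n M : ℕ} (key : Fin n → Fin M) (key-injective : Injective _≡_ _≡_ key)
         {H : Fin n → Pred ℕ 0ℓ} (H? : ∀ y → Decidable (H y)) (mono : ∀ y x → H y x → H y (suc x)) where

  module _ {B : ℕ} (ω : Vec (Vec Bool B) n) where

    Hit : Fin n → Set
    Hit y = H y (lead (lookup ω y))

    NoEarlierHit : Fin n → Set
    NoEarlierHit y = ∀ y′ → key y′ Fin.< key y → ¬ Hit y′

    NoEarlierHit? : Decidable NoEarlierHit
    NoEarlierHit? y = all? λ y′ → (key y′ Fin.<? key y) →-dec ¬? (H? y′ (lead (lookup ω y′)))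

    FirstHit : Fin n → Set
    FirstHit y = Hit y × NoEarlierHit y

    FirstHit? : Decidable FirstHit
    FirstHit? y = H? y (lead (lookup ω y)) ×-dec NoEarlierHit? y

    -- Unlike `FirstHit`, this asks for the smallest radius that hits. Any larger radius hits with
    -- one unit to spare, which is what `padded` lives on.
    FailsAt : Fin n → Set
    FailsAt y = First (H y) (lead (lookup ω y)) × NoEarlierHit y

    FailsAt? : Decidable FailsAt
    FailsAt? y = First? (H? y) (lead (lookup ω y)) ×-dec NoEarlierHit? y

    Fails : Set
    Fails = ∃ FailsAt

    Fails? : Dec Fails
    Fails? = any? FailsAt?

  NoEarlierHit-update : ∀ {B} (ω ω′ : Vec (Vec Bool B) n) y →
                        (∀ y′ → y′ ≢ y → lookup ω y′ ≡ lookup ω′ y′) →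
                        NoEarlierHit ω y → NoEarlierHit ω′ y
  NoEarlierHit-update ω ω′ y same none y′ lt h =
    none y′ lt (subst (λ β → H y′ (lead β)) (sym (same y′ λ { refl → Fin.<-irrefl refl lt })) h)

  module _ (B : ℕ) where

    private
      Ω = allVecs (bits B) n
      W = 2 ^ B

    length-bits : length (bits B) ≡ W
    length-bits = length-allVecs (false ∷ true ∷ []) B

    -- Only the radius of `y` is redrawn. `NoEarlierHit` depends on the other radii alone, so where
    -- it holds `first-hit` applies. The factor `W`, the number of bit strings, turns the truncation
    -- error of one string in `W` into 1 per outcome.
    fails-at : ∀ y → ∑ Ω (λ ω → W * (2 * 𝟙 (FailsAt? ω y))) ≤ ∑ Ω (λ ω → W * 𝟙 (FirstHit? ω y) + 1)
    fails-at y = resample (bits B) y _ _ λ ω → bound ω (NoEarlierHit? ω y)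
      where
      open ≤-Reasoning
      bound : ∀ ω → Dec (NoEarlierHit ω y) →
              ∑ (bits B) (λ β → W * (2 * 𝟙 (FailsAt? (ω [ y ]≔ β) y))) ≤
              ∑ (bits B) (λ β → W * 𝟙 (FirstHit? (ω [ y ]≔ β) y) + 1)
      bound ω (no ¬none) = ∑-mono (bits B) λ β → ≤-trans
        (≤-reflexive (trans (cong (λ x → W * (2 * x)) (𝟙-no (FailsAt? (ω [ y ]≔ β) y)
          (λ (_ , none) → ¬none (NoEarlierHit-update (ω [ y ]≔ β) ω y (λ y′ ≢y → lookup∘update′ ≢y ω β) none))))
          (*-zeroʳ W))) z≤n
      bound ω (yes none) = begin
        ∑ (bits B) (λ β → W * (2 * 𝟙 (FailsAt? (ω [ y ]≔ β) y)))
          ≤⟨ ∑-mono (bits B) (λ β → *-monoʳ-≤ W (*-monoʳ-≤ 2 (𝟙-mono (FailsAt? (ω [ y ]≔ β) y) (First? (H? y) (lead β))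
               (λ (f , _) → subst (λ β′ → First (H y) (lead β′)) (lookup∘update y ω β) f)))) ⟩
        ∑ (bits B) (λ β → W * (2 * 𝟙 (First? (H? y) (lead β))))
          ≡⟨ trans (∑-*ˡ (bits B) W _) (cong (W *_) (∑-*ˡ (bits B) 2 _)) ⟩
        W * (2 * ∑ (bits B) (λ β → 𝟙 (First? (H? y) (lead β))))
          ≤⟨ *-monoʳ-≤ W (first-hit B (H? y) (mono y)) ⟩
        W * (hits + 1)
          ≡⟨ *-distribˡ-+ W hits 1 ⟩
        W * hits + W * 1
          ≡⟨ cong₂ _+_ (∑-*ˡ (bits B) W (λ β → 𝟙 (H? y (lead β)))) (trans (∑-const (bits B) 1) (cong (_* 1) length-bits)) ⟨
        ∑ (bits B) (λ β → W * 𝟙 (H? y (lead β))) + ∑ (bits B) (λ _ → 1)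
          ≡⟨ ∑-+ (bits B) (λ β → W * 𝟙 (H? y (lead β))) (λ _ → 1) ⟨
        ∑ (bits B) (λ β → W * 𝟙 (H? y (lead β)) + 1)
          ≤⟨ ∑-mono (bits B) (λ β → +-monoˡ-≤ 1 (*-monoʳ-≤ W (𝟙-mono (H? y (lead β)) (FirstHit? (ω [ y ]≔ β) y)
               (λ h → subst (λ β′ → H y (lead β′)) (sym (lookup∘update y ω β)) h ,
                      NoEarlierHit-update ω (ω [ y ]≔ β) y (λ y′ ≢y → sym (lookup∘update′ ≢y ω β)) none)))) ⟩
        ∑ (bits B) (λ β → W * 𝟙 (FirstHit? (ω [ y ]≔ β) y) + 1) ∎
        where
        hits = ∑ (bits B) (λ β → 𝟙 (H? y (lead β)))

    firstHit-unique : ∀ ω y y′ → FirstHit {B} ω y → FirstHit ω y′ → y ≡ y′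
    firstHit-unique ω y y′ (h , none) (h′ , none′) with Fin.<-cmp (key y) (key y′)
    ... | tri< lt _ _ = ⊥-elim (none′ y lt h)
    ... | tri≈ _ eq _ = key-injective eq
    ... | tri> _ _ gt = ⊥-elim (none y′ gt h′)

    -- At most one vertex is the first hit, so the bounds of `fails-at` add up to one half and not
    -- to n halves; only the n truncation errors accumulate.
    fails : W * (2 * ∑ Ω (λ ω → 𝟙 (Fails? ω))) ≤ length Ω * (W + n)
    fails = begin
      W * (2 * ∑ Ω (λ ω → 𝟙 (Fails? ω)))
        ≡⟨ trans (∑-*ˡ Ω W _) (cong (W *_) (∑-*ˡ Ω 2 _)) ⟨
      ∑ Ω (λ ω → W * (2 * 𝟙 (Fails? ω)))
        ≤⟨ ∑-mono Ω (λ ω → *-monoʳ-≤ W (*-monoʳ-≤ 2 (𝟙≤ (Fails? ω) (λ (y , f) →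
             ≤-trans (≤-reflexive (sym (𝟙-yes (FailsAt? ω y) f))) (∑-∈ (λ y → 𝟙 (FailsAt? ω y)) (∈-allFin y)))))) ⟩
      ∑ Ω (λ ω → W * (2 * ∑ (allFin n) (λ y → 𝟙 (FailsAt? ω y))))
        ≡⟨ ∑-cong Ω (λ ω → trans (∑-*ˡ (allFin n) W _) (cong (W *_) (∑-*ˡ (allFin n) 2 _))) ⟨
      ∑ Ω (λ ω → ∑ (allFin n) (λ y → W * (2 * 𝟙 (FailsAt? ω y))))
        ≡⟨ ∑-swap Ω (allFin n) _ ⟩
      ∑ (allFin n) (λ y → ∑ Ω (λ ω → W * (2 * 𝟙 (FailsAt? ω y))))
        ≤⟨ ∑-mono (allFin n) fails-at ⟩
      ∑ (allFin n) (λ y → ∑ Ω (λ ω → W * 𝟙 (FirstHit? ω y) + 1))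
        ≡⟨ ∑-swap Ω (allFin n) _ ⟨
      ∑ Ω (λ ω → ∑ (allFin n) (λ y → W * 𝟙 (FirstHit? ω y) + 1))
        ≤⟨ ∑-mono Ω each ⟩
      ∑ Ω (λ _ → W + n)
        ≡⟨ ∑-const Ω (W + n) ⟩
      length Ω * (W + n) ∎
      where
      open ≤-Reasoning
      each : ∀ ω → ∑ (allFin n) (λ y → W * 𝟙 (FirstHit? ω y) + 1) ≤ W + n
      each ω = begin
        ∑ (allFin n) (λ y → W * 𝟙 (FirstHit? ω y) + 1)
          ≡⟨ ∑-+ (allFin n) (λ y → W * 𝟙 (FirstHit? ω y)) (λ _ → 1) ⟩
        ∑ (allFin n) (λ y → W * 𝟙 (FirstHit? ω y)) + ∑ (allFin n) (λ _ → 1)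
          ≡⟨ cong₂ _+_ (∑-*ˡ (allFin n) W (λ y → 𝟙 (FirstHit? ω y)))
               (trans (sym (length-∑ (allFin n))) (List.length-tabulate {n = n} id)) ⟩
        W * ∑ (allFin n) (λ y → 𝟙 (FirstHit? ω y)) + n
          ≤⟨ +-monoˡ-≤ n (*-monoʳ-≤ W (∑-atMostOne (allFin⁺ n) (FirstHit? ω) (firstHit-unique ω))) ⟩
        W * 1 + n
          ≡⟨ cong (_+ n) (*-identityʳ W) ⟩
        W + n ∎

    -- 5/8 = 1/2 + 1/8: one half from memorylessness, and at most n / (2W) ≤ 1/8 from truncation.
    fails≤5/8 : 4 * n ≤ W → 8 * ∑ Ω (λ ω → 𝟙 (Fails? ω)) ≤ 5 * length Ω
    fails≤5/8 4n≤W = *-cancelˡ-≤ W {{m^n≢0 2 B}} (begin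
      W * (8 * F)              ≡⟨ solve 2 (λ W F → W :* (con 8 :* F) := con 4 :* (W :* (con 2 :* F))) refl W F ⟩
      4 * (W * (2 * F))        ≤⟨ *-monoʳ-≤ 4 fails ⟩
      4 * (L * (W + n))        ≡⟨ solve 3 (λ L W n → con 4 :* (L :* (W :+ n)) := L :* (con 4 :* W :+ con 4 :* n)) refl L W n ⟩
      L * (4 * W + 4 * n)      ≤⟨ *-monoʳ-≤ L (+-monoʳ-≤ (4 * W) 4n≤W) ⟩
      L * (4 * W + W)          ≡⟨ solve 2 (λ L W → L :* (con 4 :* W :+ W) := W :* (con 5 :* L)) refl L W ⟩
      W * (5 * L)              ∎)
      where
      open ≤-Reasoning
      open +-*-Solver
      F = ∑ Ω (λ ω → 𝟙 (Fails? ω))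
      L = length Ω

-- Independence of the phases

slice : ∀ {T B} → Fin T → Vec Bool (T * B) → Vec Bool B
slice {suc T} {B} zero    x = Vec.take B x
slice {suc T} {B} (suc t) x = slice {T} t (Vec.drop B x)

-- Each phase reads a block of bits of its own, and `P` is one and the same event on such a block,
-- whatever earlier phases did. The outcomes are a product over the blocks, so the counts multiply.
independent-phases : ∀ B n {P : Pred (Vec (Vec Bool B) n) 0ℓ} (P? : Decidable P) (p q : ℕ) →
  q * ∑ (allVecs (bits B) n) (λ ω → 𝟙 (P? ω)) ≤ p * length (allVecs (bits B) n) →
  ∀ T {Q : Pred (Vec (Vec Bool (T * B)) n) 0ℓ} (Q? : Decidable Q) →
  (∀ ω → Q ω → ∀ t → P (Vec.map (slice {T} t) ω)) →
  q ^ T * ∑ (allVecs (bits (T * B)) n) (λ ω → 𝟙 (Q? ω)) ≤ p ^ T * length (allVecs (bits (T * B)) n)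
independent-phases B n {P} P? p q base T′ Q? Q⇒ = ≤-trans
  (*-monoʳ-≤ (q ^ T′) (∑-mono (allVecs (bits (T′ * B)) n) (λ ω → 𝟙-mono (Q? ω) (AllP? T′ ω) (Q⇒ ω))))
  (all-phases T′)
  where
  open ≤-Reasoning
  open +-*-Solver
  AllP : ∀ T → Vec (Vec Bool (T * B)) n → Set
  AllP T ω = ∀ t → P (Vec.map (slice {T} t) ω)
  AllP? : ∀ T → Decidable (AllP T)
  AllP? T ω = all? λ t → P? (Vec.map (slice {T} t) ω)
  S L : ∀ T → ℕ
  S T = ∑ (allVecs (bits (T * B)) n) (λ ω → 𝟙 (AllP? T ω))
  L T = length (allVecs (bits (T * B)) n)
  S₁ = ∑ (allVecs (bits B) n) (λ ω → 𝟙 (P? ω))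
  L₁ = length (allVecs (bits B) n)
  product≤ : ∀ T ω → 𝟙 (AllP? (suc T) ω) ≤ 𝟙 (P? (Vec.map (Vec.take B) ω)) * 𝟙 (AllP? T (Vec.map (Vec.drop B) ω))
  product≤ T ω = 𝟙≤ (AllP? (suc T) ω) λ all →
    ≤-reflexive (sym (cong₂ _*_ (𝟙-yes (P? _) (all zero))
      (𝟙-yes (AllP? T _) (λ t → subst P (Vec.map-∘ (slice {T} t) (Vec.drop B) ω) (all (suc t))))))
  S-suc : ∀ T → S (suc T) ≤ S₁ * S T
  S-suc T = begin
    S (suc T)
      ≤⟨ ∑-mono (allVecs (bits (B + T * B)) n) (product≤ T) ⟩
    ∑ (allVecs (bits (B + T * B)) n) (λ ω → 𝟙 (P? (Vec.map (Vec.take B) ω)) * 𝟙 (AllP? T (Vec.map (Vec.drop B) ω)))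
      ≡⟨ ∑-split B (T * B) n (λ ω₁ ω₂ → 𝟙 (P? ω₁) * 𝟙 (AllP? T ω₂)) ⟩
    ∑ (allVecs (bits B) n) (λ ω₁ → ∑ (allVecs (bits (T * B)) n) (λ ω₂ → 𝟙 (P? ω₁) * 𝟙 (AllP? T ω₂)))
      ≡⟨ ∑-cong (allVecs (bits B) n) (λ ω₁ → ∑-*ˡ (allVecs (bits (T * B)) n) (𝟙 (P? ω₁)) _) ⟩
    ∑ (allVecs (bits B) n) (λ ω₁ → 𝟙 (P? ω₁) * S T)
      ≡⟨ ∑-*ʳ (allVecs (bits B) n) (S T) _ ⟩
    S₁ * S T ∎
  L-suc : ∀ T → L₁ * L T ≡ L (suc T)
  L-suc T = begin-equality
    L₁ * L T
      ≡⟨ ∑-const (allVecs (bits B) n) (L T) ⟨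
    ∑ (allVecs (bits B) n) (λ _ → L T)
      ≡⟨ ∑-cong (allVecs (bits B) n) (λ _ → length-∑ (allVecs (bits (T * B)) n)) ⟩
    ∑ (allVecs (bits B) n) (λ _ → ∑ (allVecs (bits (T * B)) n) (λ _ → 1))
      ≡⟨ ∑-split B (T * B) n (λ _ _ → 1) ⟨
    ∑ (allVecs (bits (B + T * B)) n) (λ _ → 1)
      ≡⟨ length-∑ (allVecs (bits (B + T * B)) n) ⟨
    L (suc T) ∎
  all-phases : ∀ T → q ^ T * S T ≤ p ^ T * L T
  all-phases zero = +-monoˡ-≤ 0 (≤-trans
    (∑-mono (allVecs (bits 0) n) (λ ω → 𝟙≤ (AllP? 0 ω) (λ _ → ≤-refl)))
    (≤-reflexive (sym (length-∑ (allVecs (bits 0) n)))))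
  all-phases (suc T) = begin
    q * q ^ T * S (suc T)        ≤⟨ *-monoʳ-≤ (q * q ^ T) (S-suc T) ⟩
    q * q ^ T * (S₁ * S T)       ≡⟨ solve 4 (λ a b c d → a :* b :* (c :* d) := a :* c :* (b :* d)) refl q (q ^ T) S₁ (S T) ⟩
    q * S₁ * (q ^ T * S T)       ≤⟨ *-mono-≤ base (all-phases T) ⟩
    p * L₁ * (p ^ T * L T)       ≡⟨ solve 4 (λ a b c d → a :* b :* (c :* d) := a :* c :* (b :* d)) refl p L₁ (p ^ T) (L T) ⟩
    p * p ^ T * (L₁ * L T)       ≡⟨ cong (p * p ^ T *_) (L-suc T) ⟩
    p * p ^ T * L (suc T)        ∎

-- The problem solved in each cluster

firstSatisfying : {A : Set} {P : Pred A 0ℓ} → Decidable P → A → List A → A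
firstSatisfying P? d []       = d
firstSatisfying P? d (x ∷ xs) with P? x
... | yes _ = x
... | no  _ = firstSatisfying P? d xs

firstSatisfying-satisfies : {A : Set} {P : Pred A 0ℓ} (P? : Decidable P) (d : A) {xs : List A} {x : A} →
                            x ∈ xs → P x → P (firstSatisfying P? d xs)
firstSatisfying-satisfies P? d {x ∷ xs} x∈ p with P? x
... | yes q = q
firstSatisfying-satisfies P? d (here refl) p | no ¬p = ⊥-elim (¬p p)
firstSatisfying-satisfies P? d (there x∈)  p | no _  = firstSatisfying-satisfies P? d x∈ p

∈-allVecs : {A : Set} {xs : List A} → (∀ x → x ∈ xs) → ∀ {n} (v : Vec A n) → v ∈ allVecs xs n
∈-allVecs all []      = here refl
∈-allVecs all (x ∷ v) = ∈-cartesianProductWith⁺ Vec._∷_ (all x) (∈-allVecs all v)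

∈-Bool : ∀ s → s ∈ (false ∷ true ∷ [])
∈-Bool false = here refl
∈-Bool true  = there (here refl)

does-true⁻ : {P : Set} (P? : Dec P) → does P? ≡ true → P
does-true⁻ (yes p) _ = p

≡-true-ext : ∀ {s t : Bool} → (s ≡ true → t ≡ true) → (t ≡ true → s ≡ true) → s ≡ t
≡-true-ext {false} {false} f g = refl
≡-true-ext {false} {true}  f g = g refl
≡-true-ext {true}  {false} f g = sym (f refl)
≡-true-ext {true}  {true}  f g = refl

module ClusterProblem (M P : ℕ) where

  -- A half-edge is named by the key of its vertex and by its port.
  Name : Set
  Name = Fin M × Fin P

  -- For each port of a vertex: the name of the other half of the edge, and the label.
  Entry : Set
  Entry = Vec (Maybe Name) P × Vec Bool P

  Cluster : Set
  Cluster = Vec (Maybe Entry) M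

  Labels : Set
  Labels = Vec (Vec Bool P) M

  at : Labels → Name → Bool
  at m (x , p) = lookup (lookup m x) p

  old : Cluster → Name → Bool
  old c (x , p) = maybe (λ (_ , l) → lookup l p) false (lookup c x)

  peer : Cluster → Name → Maybe Name
  peer c (x , p) = lookup c x >>= λ (ps , _) → lookup ps p

  -- `none` also stands for ports beyond the degree and for keys without an entry, as the table has
  -- room for all names.
  data Link : Set where
    none leaving : Link
    internal     : Name → Link

  link : Cluster → Name → Link
  link c nm with peer c nm
  ... | nothing = none
  ... | just (y , q) with lookup c y
  ...   | nothing = leaving
  ...   | just _  = internal (y , q)

  -- The recursion of `Closed`, carried out on the table. A path out of the cluster arrives at a key
  -- without an entry, where `Is-just` fails.
  Closedᶜ : Cluster → ℕ → Fin M → Set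
  Closedᶜ c zero    x = Is-just (lookup c x)
  Closedᶜ c (suc i) x = Is-just (lookup c x) × (∀ p → MaybeAll.All (Closedᶜ c i ∘ proj₁) (peer c (x , p)))

  Closedᶜ? : ∀ c i → Decidable (Closedᶜ c i)
  Closedᶜ? c zero    x = MaybeAny.dec (λ _ → yes tt) (lookup c x)
  Closedᶜ? c (suc i) x = MaybeAny.dec (λ _ → yes tt) (lookup c x) ×-dec
                         all? λ p → MaybeAll.dec (Closedᶜ? c i ∘ proj₁) (peer c (x , p))

  module _ (k R : ℕ) (c : Cluster) where

    -- A `leaving` half-edge is frozen. The cluster at the other end freezes its half as well while
    -- solving its own problem, and so the solutions of all clusters fit together.
    OK : Labels → Name → Link → Set
    OK m nm none           = ⊤
    OK m nm leaving        = at m nm ≡ old c nm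
    OK m nm (internal nm′) =
      ¬ (at m nm ≡ true × at m nm′ ≡ true) ×
      (old c nm ≡ true ⊎ old c nm′ ≡ true → at m nm ≡ true ⊎ at m nm′ ≡ true) ×
      (Closedᶜ c R (proj₁ nm) → at m nm ≡ true ⊎ at m nm′ ≡ true)

    OK? : ∀ m nm l → Dec (OK m nm l)
    OK? m nm none           = yes tt
    OK? m nm leaving        = at m nm Bool.≟ old c nm
    OK? m nm (internal nm′) =
      ¬? ((at m nm Bool.≟ true) ×-dec (at m nm′ Bool.≟ true)) ×-dec
      ((((old c nm Bool.≟ true) ⊎-dec (old c nm′ Bool.≟ true)) →-dec ((at m nm Bool.≟ true) ⊎-dec (at m nm′ Bool.≟ true))) ×-dec
      (Closedᶜ? c R (proj₁ nm) →-dec ((at m nm Bool.≟ true) ⊎-dec (at m nm′ Bool.≟ true))))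

    ownedPorts : Labels → Fin M → List (Fin P)
    ownedPorts m x = filter (λ p → at m (x , p) Bool.≟ true) (allFin P)

    Acceptable : Pred Labels 0ℓ
    Acceptable m = ∀ x → length (ownedPorts m x) ≤ k × (∀ p → OK m (x , p) (link c (x , p)))

    Acceptable? : Decidable Acceptable
    Acceptable? m = all? λ x → (length (ownedPorts m x) ≤? k) ×-dec all? (λ p → OK? m (x , p) (link c (x , p)))

    abstract
      -- Exhaustive search in a fixed order makes the labels a function of the table alone, so that
      -- all vertices with the same table agree. Being abstract, it is not unfolded during type
      -- checking.
      solve : Labels
      solve = firstSatisfying Acceptable? (Vec.replicate M (Vec.replicate P false))
                (allVecs (allVecs (false ∷ true ∷ []) P) M)

      solve-acceptable : ∃ Acceptable → Acceptable solve
      solve-acceptable (m , a) =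
        firstSatisfying-satisfies Acceptable? _ (∈-allVecs (∈-allVecs ∈-Bool) m) a

-- Transfer between the graph and the table of a cluster

record Naming (G : Multigraph) (M P : ℕ) : Set where
  field
    key           : Vertex G → Fin M
    key-injective : Injective _≡_ _≡_ key
    port          : Dart G → Fin P
    port-injective : ∀ {h h′} → tail G h ≡ tail G h′ → port h ≡ port h′ → h ≡ h′

  name : Dart G → Fin M × Fin P
  name h = key (tail G h) , port h

  name-injective : ∀ {h h′} → name h ≡ name h′ → h ≡ h′
  name-injective eq = port-injective (key-injective (cong proj₁ eq)) (cong proj₂ eq)

  IsPeers : Vertex G → Vec (Maybe (Fin M × Fin P)) P → Set
  IsPeers v ps =
    (∀ h → tail G h ≡ v → lookup ps (port h) ≡ just (name (reverse G h))) ×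
    (∀ p nm → lookup ps p ≡ just nm → ∃[ h ] tail G h ≡ v × port h ≡ p × name (reverse G h) ≡ nm)

module _ {G : Multigraph} {M P : ℕ} (N : Naming G M P) where
  open Multigraph G
  open Naming N
  open ClusterProblem M P

  labellingOf : (Vertex G → Vec Bool P) → Labelling G
  labellingOf ℓ h = lookup (ℓ (tail G h)) (port h)

  outdegree-labellingOf : ∀ ℓ v → outdegree G (labellingOf ℓ) v ≤
                                  length (filter (λ p → lookup (ℓ v) p Bool.≟ true) (allFin P))
  outdegree-labellingOf ℓ v =
    length-injective-relation (λ h p → tail G h ≡ v × port h ≡ p)
      (filter⁺ (owned? G (labellingOf ℓ) v) (darts-unique G))
      (λ h h∈ → let (t , o) = proj₂ (∈-filter⁻ (owned? G (labellingOf ℓ) v) {xs = darts G} h∈) in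
        port h , ∈-filter⁺ (λ p → lookup (ℓ v) p Bool.≟ true) (∈-allFin (port h))
                   (subst (λ u → lookup (ℓ u) (port h) ≡ true) t o) , t , refl)
      (λ (t , p) (t′ , p′) → port-injective (trans t (sym t′)) (trans p (sym p′)))

  record Describes (c : Cluster) (T : Pred (Vertex G) 0ℓ) (ℓ : Vertex G → Vec Bool P) : Set where
    field
      peersOf : Vertex G → Vec (Maybe Name) P
      isPeers : ∀ v → IsPeers v (peersOf v)
      present : ∀ v → T v → lookup c (key v) ≡ just (peersOf v , ℓ v)
      only    : ∀ z e → lookup c z ≡ just e → ∃[ v ] T v × key v ≡ z

  module _ {c : Cluster} {T : Pred (Vertex G) 0ℓ} (T? : Decidable T) {ℓ : Vertex G → Vec Bool P}
           (desc : Describes c T ℓ) (k : ℕ) where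
    open Describes desc

    private
      λ₀ = labellingOf ℓ

    lookup-absent : ∀ v → ¬ T v → lookup c (key v) ≡ nothing
    lookup-absent v ∉T with lookup c (key v) in eq
    ... | nothing = refl
    ... | just e with u , t , same ← only (key v) e eq = ⊥-elim (∉T (subst T (key-injective same) t))

    is-just⇒T : ∀ v → Is-just (lookup c (key v)) → T v
    is-just⇒T v j with T? v
    ... | yes t = t
    ... | no ∉T rewrite lookup-absent v ∉T with () ← j

    T⇒is-just : ∀ v → T v → Is-just (lookup c (key v))
    T⇒is-just v t rewrite present v t = MaybeAny.just tt

    old-name : ∀ h → T (tail G h) → old c (name h) ≡ λ₀ h
    old-name h t rewrite present (tail G h) t = refl

    peer-name : ∀ h → T (tail G h) → peer c (name h) ≡ just (name (reverse G h))
    peer-name h t rewrite present (tail G h) t = proj₁ (isPeers (tail G h)) h refl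

    peer-just : ∀ {nm nm′} → peer c nm ≡ just nm′ →
                ∃[ h ] name h ≡ nm × name (reverse G h) ≡ nm′ × T (tail G h)
    peer-just {x , p} eq with lookup c x in eqx
    peer-just {x , p} () | nothing
    peer-just {x , p} eq | just (ps , l) with u , t , refl ← only x (ps , l) eqx
      with refl ← trans (sym eqx) (present u t)
      with h , refl , refl , refl ← proj₂ (isPeers u) p _ eq = h , refl , refl , t

    link-internal : ∀ h → T (tail G h) → T (head G h) → link c (name h) ≡ internal (name (reverse G h))
    link-internal h t t′ rewrite peer-name h t | present (head G h) t′ = refl

    link-leaving : ∀ h → T (tail G h) → ¬ T (head G h) → link c (name h) ≡ leaving
    link-leaving h t ∉T rewrite peer-name h t | lookup-absent (head G h) ∉T = refl

    Closed⇒Closedᶜ : ∀ i v → Closed G k T? i v → Closedᶜ c i (key v)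
    Closed⇒Closedᶜ zero    v t        = T⇒is-just v t
    Closed⇒Closedᶜ (suc i) v (t , cl) = T⇒is-just v t , each
      where
      each : ∀ p → MaybeAll.All (Closedᶜ c i ∘ proj₁) (peer c (key v , p))
      each p with peer c (key v , p) in eq
      ... | nothing = nothing
      ... | just nm with h , same , refl , _ ← peer-just eq =
            just (Closed⇒Closedᶜ i (head G h) (cl h (key-injective (cong proj₁ same))))

    Closedᶜ⇒Closed : ∀ i v → Closedᶜ c i (key v) → Closed G k T? i v
    Closedᶜ⇒Closed zero    v j        = is-just⇒T v j
    Closedᶜ⇒Closed (suc i) v (j , cl) = is-just⇒T v j , each
      where
      each : ∀ h → tail G h ≡ v → Closed G k T? i (head G h)
      each h refl with all ← cl (port h) rewrite peer-name h (is-just⇒T v j) with just cl′ ← all =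
        Closedᶜ⇒Closed i (head G h) cl′

    module _ (R : ℕ) (λ′ : Labelling G) (partial : Partial G k λ′) (extends : Extends G k T? λ₀ λ′)
             (oriented : ∀ h → Closed G k T? R (tail G h) → Oriented G λ′ h) where
      open Partial partial
      open Extends extends

      private
        Has : Name → Pred (Dart G) 0ℓ
        Has nm h = name h ≡ nm × T (tail G h) × λ′ h ≡ true

        has? : ∀ nm → Decidable (Has nm)
        has? nm h = Product.≡-dec _≟_ _≟_ (name h) nm ×-dec (T? (tail G h) ×-dec (λ′ h Bool.≟ true))

        -- Names of no half-edge in `T` are labelled `false`, so that the bound `k` also holds at
        -- keys without a vertex.
        m : Labels
        m = tabulate λ x → tabulate λ p → does (∃dart? G (has? (x , p)))

        at-m : ∀ nm → at m nm ≡ does (∃dart? G (has? nm))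
        at-m (x , p) = trans (cong (λ v → lookup v p) (lookup∘tabulate _ x)) (lookup∘tabulate _ p)

        at-m⁻ : ∀ {nm} → at m nm ≡ true → ∃ (Has nm)
        at-m⁻ {nm} eq = does-true⁻ (∃dart? G (has? nm)) (trans (sym (at-m nm)) eq)

        at-m⁺ : ∀ h → T (tail G h) → λ′ h ≡ true → at m (name h) ≡ true
        at-m⁺ h t o = trans (at-m (name h)) (dec-true (∃dart? G (has? (name h))) (h , refl , t , o))

        at-name⁻ : ∀ h → at m (name h) ≡ true → λ′ h ≡ true
        at-name⁻ h eq with g , same , _ , o ← at-m⁻ {name h} eq = subst (λ g → λ′ g ≡ true) (name-injective same) o

        orient-m : ∀ h → T (tail G h) → T (head G h) → Oriented G λ′ h →
                   at m (name h) ≡ true ⊎ at m (name (reverse G h)) ≡ true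
        orient-m h t t′ = Sum.map (at-m⁺ h t) (at-m⁺ (reverse G h) t′)

        bound : ∀ x → length (ownedPorts k R c m x) ≤ k
        bound x with any? (λ v → key v ≟ x)
        ... | yes (v , refl) = ≤-trans
              (length-injective-relation (λ p h → name h ≡ (x , p))
                (filter⁺ (λ p → at m (x , p) Bool.≟ true) (allFin⁺ P))
                (λ p p∈ → let (h , same , t , o) = at-m⁻ (proj₂ (∈-filter⁻ (λ p → at m (x , p) Bool.≟ true) {xs = allFin P} p∈)) in
                  h , ∈-filter⁺ (owned? G λ′ v) (∈-darts G h) (key-injective (cong proj₁ same) , o) , same)
                (λ eq eq′ → cong proj₂ (trans (sym eq) eq′)))
              (bounded v)
        ... | no ∄v = ≤-trans
              (length-injective-relation {B = ⊥} (λ _ _ → ⊥) {ys = []}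
                (filter⁺ (λ p → at m (x , p) Bool.≟ true) (allFin⁺ P))
                (λ p p∈ → let (h , same , _) = at-m⁻ (proj₂ (∈-filter⁻ (λ p → at m (x , p) Bool.≟ true) {xs = allFin P} p∈)) in
                  ⊥-elim (∄v (tail G h , cong proj₁ same)))
                (λ ()))
              z≤n

        ok-name : ∀ h → T (tail G h) → OK k R c m (name h) (link c (name h))
        ok-name h t with T? (head G h)
        ... | no ∉T = subst (OK k R c m (name h)) (sym (link-leaving h t ∉T))
                (≡-true-ext (λ a → trans same (at-name⁻ h a)) (λ o → at-m⁺ h t (trans (sym same) o)))
          where
          same : old c (name h) ≡ λ′ h
          same = trans (old-name h t) (sym (local h (∉T ∘ proj₂)))
        ... | yes t′ = subst (OK k R c m (name h)) (sym (link-internal h t t′))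
                ((λ (a , a′) → exclusive h (at-name⁻ h a) (at-name⁻ (reverse G h) a′)) ,
                 (λ o → orient-m h t t′ (keeps h (Sum.map (trans (sym (old-name h t)))
                                                          (trans (sym (old-name (reverse G h) t′))) o))) ,
                 (λ cl → orient-m h t t′ (oriented h (Closedᶜ⇒Closed R (tail G h) cl))))

        ok : ∀ nm → OK k R c m nm (link c nm)
        ok nm = split (peer c nm) refl
          where
          split : ∀ l → peer c nm ≡ l → OK k R c m nm (link c nm)
          split nothing    eq rewrite eq = tt
          split (just nm′) eq with h , refl , _ , t ← peer-just {nm} eq = ok-name h t

      acceptable : ∃ (Acceptable k R c)
      acceptable = m , λ x → bound x , λ p → ok (x , p)

    -- The augmentations of `orient-closed` only prove that the search has something to find; what
    -- it finds may be a different solution.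
    solve-correct : ∀ {a} → PartitionsIntoPseudoForests G a → ∀ {m} → a * suc (suc m) ≤ k * suc m →
                    ∀ J → #V < 2 ^ J → Partial G k λ₀ →
                    Acceptable k (suc (suc m * J)) c (solve k (suc (suc m * J)) c)
    solve-correct parts {m} a≤k J V< partial
      with λ′ , partial′ , extends , oriented ← orient-closed G k T? parts a≤k J V< partial =
      solve-acceptable k R c (acceptable R λ′ partial′ extends oriented)
      where R = suc (suc m * J)

    module _ (R : ℕ) {m : Labels} (acc : Acceptable k R c m) where

      acceptable-bounded : ∀ v → length (ownedPorts k R c m (key v)) ≤ k
      acceptable-bounded v = proj₁ (acc (key v))

      acceptable-leaving : ∀ h → T (tail G h) → ¬ T (head G h) → at m (name h) ≡ λ₀ h
      acceptable-leaving h t ∉T =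
        trans (subst (OK k R c m (name h)) (link-leaving h t ∉T) (proj₂ (acc (key (tail G h))) (port h)))
              (old-name h t)

      private
        internal-ok : ∀ h → T (tail G h) → T (head G h) → OK k R c m (name h) (internal (name (reverse G h)))
        internal-ok h t t′ =
          subst (OK k R c m (name h)) (link-internal h t t′) (proj₂ (acc (key (tail G h))) (port h))

      acceptable-exclusive : ∀ h → T (tail G h) → T (head G h) →
                             at m (name h) ≡ true → at m (name (reverse G h)) ≢ true
      acceptable-exclusive h t t′ a a′ = proj₁ (internal-ok h t t′) (a , a′)

      acceptable-keeps : ∀ h → T (tail G h) → T (head G h) → Oriented G λ₀ h →
                         at m (name h) ≡ true ⊎ at m (name (reverse G h)) ≡ true
      acceptable-keeps h t t′ o = proj₁ (proj₂ (internal-ok h t t′))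
        (Sum.map (trans (old-name h t)) (trans (old-name (reverse G h) t′)) o)

      acceptable-orients : ∀ h → T (tail G h) → T (head G h) → Closed G k T? R (tail G h) →
                           at m (name h) ≡ true ⊎ at m (name (reverse G h)) ≡ true
      acceptable-orients h t t′ cl = proj₂ (proj₂ (internal-ok h t t′)) (Closed⇒Closedᶜ R (tail G h) cl)

-- Clusters formed by balls of random radius

IsLeast : ∀ {n} → Pred (Fin n) 0ℓ → Pred (Fin n) 0ℓ
IsLeast P z = P z × (∀ z′ → z′ Fin.< z → ¬ P z′)

least : ∀ {n} {P : Pred (Fin n) 0ℓ} → Decidable P → Maybe (Fin n)
least {zero}  P? = nothing
least {suc n} P? with P? zero
... | yes _ = just zero
... | no  _ = Maybe.map suc (least (P? ∘ suc))

least-correct : ∀ {n} {P : Pred (Fin n) 0ℓ} (P? : Decidable P) {z} → IsLeast P z → least P? ≡ just z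
least-correct {suc n} P? {zero} (p , _) with P? zero
... | yes _ = refl
... | no ¬p = ⊥-elim (¬p p)
least-correct {suc n} P? {suc z} (p , below) with P? zero
... | yes p₀ = ⊥-elim (below zero (s≤s z≤n) p₀)
... | no  _  = cong (Maybe.map suc) (least-correct (P? ∘ suc) (p , λ z′ lt → below (suc z′) (s≤s lt)))

least-exists : ∀ {n} {P : Pred (Fin n) 0ℓ} → Decidable P → ∃ P → ∃ (IsLeast P)
least-exists {suc n} {P} P? (z , p) with P? zero
... | yes p₀ = zero , p₀ , λ _ ()
... | no ¬p₀ with z
...   | zero = ⊥-elim (¬p₀ p)
...   | suc z′ with z″ , p″ , below ← least-exists (P? ∘ suc) (z′ , p) =
        suc z″ , p″ , λ { zero _ → ¬p₀ ; (suc y) (s≤s lt) → below y lt }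

lead≤ : ∀ {B} (β : Vec Bool B) → lead β ≤ B
lead≤ []          = z≤n
lead≤ (true ∷ β)  = s≤s (lead≤ β)
lead≤ (false ∷ β) = z≤n

module _ (G : Multigraph) where
  open Multigraph G

  data Within : ℕ → Vertex G → Vertex G → Set where
    stay : ∀ {i x} → Within i x x
    move : ∀ {i y} h → Within i (head G h) y → Within (suc i) (tail G h) y

  Within-mono : ∀ {i j x y} → i ≤ j → Within i x y → Within j x y
  Within-mono le       stay       = stay
  Within-mono (s≤s le) (move h w) = move h (Within-mono le w)

  Within-trans : ∀ {i j x y z} → Within i x y → Within j y z → Within (i + j) x z
  Within-trans {i} {j} stay w = Within-mono (m≤n+m j i) w
  Within-trans (move h w) w′  = move h (Within-trans w w′)

  Within-sym : ∀ {i x y} → Within i x y → Within i y x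
  Within-sym stay = stay
  Within-sym {suc i} {y = y} (move h w) =
    subst (λ n → Within n y (tail G h)) (+-comm i 1)
      (Within-trans (Within-sym w)
        (subst (Within 1 (head G h)) (cong (tail G) (reverse-reverse G h)) (move (reverse G h) stay)))

  Within? : ∀ i x y → Dec (Within i x y)
  Within? zero    x y = map′ (λ { refl → stay }) (λ { stay → refl }) (x ≟ y)
  Within? (suc i) x y = map′
    (λ { (inj₁ refl) → stay ; (inj₂ (h , refl , w)) → move h w })
    (λ { stay → inj₁ refl ; (move h w) → inj₂ (h , refl , w) })
    ((x ≟ y) ⊎-dec ∃dart? G (λ h → (tail G h ≟ x) ×-dec Within? i (head G h) y))

  Within⇒Closed : ∀ k {T : Pred (Vertex G) 0ℓ} (T? : Decidable T) i v →
                  (∀ u → Within i v u → T u) → Closed G k T? i v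
  Within⇒Closed k T? zero    v all = all v stay
  Within⇒Closed k T? (suc i) v all =
    all v stay , λ { h refl → Within⇒Closed k T? i (head G h) (λ u w → all u (move h w)) }

  module _ {M : ℕ} (key : Vertex G → Fin M) (D : ℕ) (X : Vertex G → ℕ) where

    Covered : Vertex G → Pred (Fin M) 0ℓ
    Covered x z = ∃[ y ] key y ≡ z × Within (X y * D) x y

  module _ {M : ℕ} (key : Vertex G → Fin M) (key-injective : Injective _≡_ _≡_ key) (R : ℕ) (v : Vertex G) where

    -- The ball of radius `x * (2 * R)` around `y` meets the `R`-ball of `v`. Enlarged by 2 R, the
    -- diameter bound of the latter, it contains it; this is why radii are multiples of 2 R.
    Near : Vertex G → Pred ℕ 0ℓ
    Near y x = Within (x * (2 * R) + R) v y

    Near? : ∀ y → Decidable (Near y)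
    Near? y x = Within? (x * (2 * R) + R) v y

    Near-suc : ∀ y x → Near y x → Near y (suc x)
    Near-suc y x = Within-mono (+-monoˡ-≤ R (m≤n+m (x * (2 * R)) (2 * R)))

    -- Unless the first vertex y, in the order of the keys, whose ball comes within
    -- distance R of v has a radius too small by one unit 2 R, the ball of y
    -- contains the R-ball of v, which then lies in the cluster of y.
    padded : ∀ {B} (ω : Vec (Vec Bool B) #V) → ¬ Fails key key-injective Near? Near-suc ω →
             ∃[ z ] ∀ u → Within R v u → IsLeast (Covered key (2 * R) (λ y → lead (lookup ω y)) u) z
    padded ω ¬fails
      -- `v` is near itself whatever its radius, so there is a first hit.
      with z , (y , refl , hit) , below ← least-exists
             (λ z → any? (λ y → (key y ≟ z) ×-dec Near? y (lead (lookup ω y))))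
             (key v , v , refl , stay)
      with Previous? (Near? y) (lead (lookup ω y))
    ... | no ¬p = ⊥-elim (¬fails (y , (hit , ¬p) , λ y′ lt h → below (key y′) lt (y′ , refl , h)))
    ... | yes p = key y , λ u w → (y , refl , contains (lead (lookup ω y)) p u w) , earlier u w
      where
      contains : ∀ x → Previous (Near y) x → ∀ u → Within R v u → Within (x * (2 * R)) u y
      contains (suc x) near u w = subst (λ i → Within i u y)
        (solve 2 (λ R q → R :+ (q :+ R) := (con 2 :* R) :+ q) refl R (x * (2 * R)))
        (Within-trans (Within-sym w) near)
        where open +-*-Solver
      -- A ball that covers a vertex of the `R`-ball of `v` also comes within distance `R` of `v`;
      -- one with a smaller key would contradict the choice of `y`.
      earlier : ∀ u → Within R v u → ∀ z′ → z′ Fin.< key y → ¬ Covered key (2 * R) (λ y → lead (lookup ω y)) u z′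
      earlier u w _ lt (y′ , refl , c) = below (key y′) lt (y′ , refl ,
        subst (λ i → Within i v y′) (+-comm R _) (Within-trans w c))

-- Bijective numeration in base two, with digits 1 and 2. Ordinary binary would identify IDs that
-- differ only in `false` bits at their end.
encode : ID → ℕ
encode []           = 0
encode (false ∷ bs) = 1 + 2 * encode bs
encode (true ∷ bs)  = 2 + 2 * encode bs

encode-injective : Injective _≡_ _≡_ encode
encode-injective {[]}         {[]}         eq = refl
encode-injective {[]}         {false ∷ _}  ()
encode-injective {[]}         {true ∷ _}   ()
encode-injective {false ∷ _}  {[]}         ()
encode-injective {true ∷ _}   {[]}         ()
encode-injective {false ∷ bs} {false ∷ cs} eq =
  cong (false ∷_) (encode-injective (*-cancelˡ-≡ _ _ 2 (suc-injective eq)))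
encode-injective {true ∷ bs}  {true ∷ cs}  eq =
  cong (true ∷_) (encode-injective (*-cancelˡ-≡ _ _ 2 (suc-injective (suc-injective eq))))
encode-injective {false ∷ bs} {true ∷ cs}  eq = ⊥-elim (even≢odd (encode bs) (encode cs) (suc-injective eq))
encode-injective {true ∷ bs}  {false ∷ cs} eq = ⊥-elim (even≢odd (encode cs) (encode bs) (sym (suc-injective eq)))

encode-bound : ∀ bs → 2 + encode bs ≤ 2 ^ suc (length bs)
encode-bound [] = ≤-refl
encode-bound (b ∷ bs) = ≤-trans (cons b) (*-monoʳ-≤ 2 (encode-bound bs))
  where
  cons : ∀ b → 2 + encode (b ∷ bs) ≤ 2 * (2 + encode bs)
  cons true  = ≤-reflexive (solve 1 (λ x → con 2 :+ (con 2 :+ con 2 :* x) := con 2 :* (con 2 :+ x)) refl (encode bs))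
    where open +-*-Solver
  cons false = ≤-trans (n≤1+n _) (cons true)

toℕ-mod : ∀ {m n} .{{_ : NonZero n}} → m < n → toℕ (m mod n) ≡ m
toℕ-mod m<n = trans (toℕ-fromℕ< _) (m<n⇒m%n≡m m<n)

nth : {A : Set} → List A → ℕ → Maybe A
nth []       _       = nothing
nth (x ∷ xs) zero    = just x
nth (x ∷ xs) (suc i) = nth xs i

nth-tabulate : {A : Set} {n : ℕ} (f : Fin n → A) (i : Fin n) → nth (List.tabulate f) (toℕ i) ≡ just (f i)
nth-tabulate f zero    = refl
nth-tabulate f (suc i) = nth-tabulate (f ∘ suc) i

nth-tabulate⁻ : {A : Set} {n : ℕ} (f : Fin n → A) (j : ℕ) {x : A} → nth (List.tabulate f) j ≡ just x →
                ∃[ i ] toℕ i ≡ j × f i ≡ x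
nth-tabulate⁻ {n = suc n} f zero    refl = zero , refl , refl
nth-tabulate⁻ {n = suc n} f (suc j) eq with i , refl , eq′ ← nth-tabulate⁻ (f ∘ suc) j eq = suc i , refl , eq′

Maybe-ext : {C : Set} {a b : Maybe C} → (∀ c → a ≡ just c → b ≡ just c) → (∀ c → b ≡ just c → a ≡ just c) → a ≡ b
Maybe-ext {a = just c}            f g = sym (f c refl)
Maybe-ext {a = nothing} {just c}  f g = g c refl
Maybe-ext {a = nothing} {nothing} f g = refl

firstJust : {A C : Set} → (A → Maybe C) → List A → Maybe C
firstJust g []       = nothing
firstJust g (x ∷ xs) = g x <∣> firstJust g xs

<∣>-just : {C : Set} (a b : Maybe C) {c : C} → (a <∣> b) ≡ just c → a ≡ just c ⊎ b ≡ just c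
<∣>-just (just _) b eq = inj₁ eq
<∣>-just nothing  b eq = inj₂ eq

firstJust⁻ : {A C : Set} (g : A → Maybe C) (xs : List A) {c : C} → firstJust g xs ≡ just c →
             ∃[ x ] x ∈ xs × g x ≡ just c
firstJust⁻ g (x ∷ xs) eq with <∣>-just (g x) (firstJust g xs) eq
... | inj₁ eq′ = x , here refl , eq′
... | inj₂ eq′ with y , y∈ , eq″ ← firstJust⁻ g xs eq′ = y , there y∈ , eq″

<∣>-justˡ : {C : Set} (a b : Maybe C) → ∃ (λ c → a ≡ just c) → ∃ λ c → (a <∣> b) ≡ just c
<∣>-justˡ (just c) b _ = c , refl

<∣>-justʳ : {C : Set} (a b : Maybe C) → ∃ (λ c → b ≡ just c) → ∃ λ c → (a <∣> b) ≡ just c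
<∣>-justʳ (just c) b _ = c , refl
<∣>-justʳ nothing  b p = p

firstJust⁺ : {A C : Set} (g : A → Maybe C) {xs : List A} {x : A} → x ∈ xs → ∃ (λ c → g x ≡ just c) →
             ∃ λ c → firstJust g xs ≡ just c
firstJust⁺ g {x ∷ xs} (here refl) p = <∣>-justˡ (g x) (firstJust g xs) p
firstJust⁺ g {x ∷ xs} (there x∈)  p = <∣>-justʳ (g x) (firstJust g xs) (firstJust⁺ g x∈ p)

-- What a vertex knows: its key and random bits; after each further round, its
-- previous view, and for each of its ports the view and the port received there.
data View (M P b : ℕ) : Set where
  start : Fin M → Vec Bool b → View M P b
  round : View M P b → List (Fin P × View M P b) → View M P b

module _ {M P b : ℕ} where

  ownKey : View M P b → Fin M
  ownKey (start x _) = x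
  ownKey (round w _) = ownKey w

  ownBits : View M P b → Vec Bool b
  ownBits (start _ β) = β
  ownBits (round w _) = ownBits w

  previous : View M P b → View M P b
  previous (start x β) = start x β
  previous (round w _) = w

  received : View M P b → List (Fin P × View M P b)
  received (start _ _)  = []
  received (round _ ms) = ms

  toName : Fin P × View M P b → Fin M × Fin P
  toName (q , u) = ownKey u , q

  peerAt : List (Fin P × View M P b) → Fin P → Maybe (Fin M × Fin P)
  peerAt ms p = Maybe.map toName (nth ms (toℕ p))

  peers : View M P b → Vec (Maybe (Fin M × Fin P)) P
  peers w = tabulate (peerAt (received w))

  -- A query for the vertex with key `z` within distance `i`. Stepping into a received view or into
  -- the own previous one goes back exactly one round, so every answer describes that vertex as it
  -- was `i` rounds ago, along whichever path it came.
  flood : {A : Set} → ℕ → (View M P b → A) → View M P b → Fin M → Maybe A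
  flood zero    f w z = if does (z ≟ ownKey w) then just (f w) else nothing
  flood (suc i) f w z = flood i f (previous w) z <∣> firstJust (λ (_ , u) → flood i f u z) (received w)

-- The algorithm

module Algorithm (s Δ k R T B : ℕ) where

  -- `M` exceeds every encoded ID. `W` bounds the distance in the whole graph between two vertices
  -- of a cluster: both are within `B * D` of its center, which may itself belong to another
  -- cluster.
  M P D W : ℕ
  M = suc (2 ^ suc s)
  P = suc Δ
  D = 2 * R
  W = B * D + B * D

  View′ : Set
  View′ = View M P (T * B)

  open ClusterProblem M P

  radius : Fin T → View′ → ℕ
  radius t w = lead (slice {T} t (ownBits w))

  -- How far to search depends on the radius to be found. All values `j` up to `B` are tried; `j` is
  -- right when the vertex found within `j * D` reports the radius `j`.
  CoveredBy : Fin T → View′ → Pred (Fin M) 0ℓ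
  CoveredBy t w z = ∃[ j ] flood (toℕ {suc B} j * D) (radius t) w z ≡ just (toℕ j)

  coveredBy? : ∀ t w → Decidable (CoveredBy t w)
  coveredBy? t w z = any? λ j → Maybe.≡-dec ℕ._≟_ (flood (toℕ j * D) (radius t) w z) (just (toℕ j))

  center : Fin T → View′ → Maybe (Fin M)
  center t w = least (coveredBy? t w)

  _≟ᶜ_ : DecidableEquality (Maybe (Fin M))
  _≟ᶜ_ = Maybe.≡-dec _≟_

  sameCluster : Maybe (Fin M) → Maybe (Maybe (Fin M) × Entry) → Maybe Entry
  sameCluster x nothing = nothing
  sameCluster x (just (y , e)) = if does (y ≟ᶜ x) then just e else nothing

  sameCluster-yes : ∀ {x y e} → y ≡ x → sameCluster x (just (y , e)) ≡ just e
  sameCluster-yes {x} {y} eq rewrite dec-true (y ≟ᶜ x) eq = refl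

  sameCluster⁻ : ∀ x o {e} → sameCluster x o ≡ just e → o ≡ just (x , e)
  sameCluster⁻ x (just (y , e)) eq with y ≟ᶜ x
  sameCluster⁻ x (just (y , e)) refl | yes refl = refl

  info : Fin T → (View′ → Vec Bool P) → View′ → Maybe (Fin M) × Entry
  info t lab w = center t w , peers w , lab w

  clusterAt : Fin T → (View′ → Vec Bool P) → View′ → Fin M → Maybe Entry
  clusterAt t lab w z = sameCluster (center t w) (flood W (info t lab) w z)

  cluster : Fin T → (View′ → Vec Bool P) → View′ → Cluster
  cluster t lab w = tabulate (clusterAt t lab w)

  -- The head of the list is the latest phase. Labels of earlier phases are not stored: `cluster`
  -- recomputes them, for all members, from the views of `W` rounds before.
  label : List (Fin T) → View′ → Vec Bool P
  label []       w = Vec.replicate P false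
  label (t ∷ ts) w = lookup (solve k R (cluster t (label ts) w)) (ownKey w)

  -- The base value is what `center` needs before the first phase. It also provides the one round
  -- after which the other ends of the edges are known.
  depth : List (Fin T) → ℕ
  depth []       = B * D
  depth (t ∷ ts) = W + depth ts

  -- An algorithm is defined at all degrees and IDs. Within the promised bounds this reduction, like
  -- that of the key modulo `M`, changes nothing.
  toPort : ∀ {d} → Fin d → Fin P
  toPort i = toℕ i mod P

  algorithm : LocalAlgorithm (T * B)
  algorithm = record
    { State   = λ _ → View′
    ; Message = Fin P × View′
    ; init    = λ _ x β → start (encode x mod M) β
    ; send    = λ w → tabulate λ i → toPort i , w
    ; receive = λ w ms → round w (List.tabulate (lookup ms))
    ; output  = λ w → tabulate λ i → lookup (label (allFin T) w) (toPort i)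
    }

  module Names {G : Multigraph} (N : Network G s) (deg≤Δ : ∀ v → degree G v ≤ Δ) where
    open Network N renaming (id to identifier)

    key : Vertex G → Fin M
    key v = encode (identifier v) mod M

    key-injective : Injective _≡_ _≡_ key
    key-injective {u} {v} eq = id-unique (encode-injective
      (trans (sym (toℕ-mod (small u))) (trans (cong toℕ eq) (toℕ-mod (small v)))))
      where
      small : ∀ v → encode (identifier v) < M
      small v = s≤s (≤-trans (≤-trans (m≤n+m _ 2) (encode-bound (identifier v)))
                             (^-monoʳ-≤ 2 (s≤s (id-length v))))

    toPort-injective : ∀ {v v′} (i : Fin (degree G v)) (j : Fin (degree G v′)) → toPort i ≡ toPort j → toℕ i ≡ toℕ j
    toPort-injective {v} {v′} i j eq = trans (sym (toℕ-toPort v i)) (trans (cong toℕ eq) (toℕ-toPort v′ j))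
      where
      toℕ-toPort : ∀ v (i : Fin (degree G v)) → toℕ (toPort i) ≡ toℕ i
      toℕ-toPort v i = toℕ-mod (≤-trans (toℕ<n i) (≤-trans (deg≤Δ v) (n≤1+n Δ)))

    portOf-from : ∀ {v h} (t : tail G h ≡ v) → toℕ (portOf h) ≡ toℕ (Inverse.from (ports v) (h , t))
    portOf-from refl = refl

    dartAt-portOf : ∀ h → dartAt (tail G h) (portOf h) ≡ h
    dartAt-portOf h = cong proj₁ (Inverse.strictlyInverseˡ (ports (tail G h)) (h , refl))

    portOf-dartAt : ∀ v i → toℕ (portOf (dartAt v i)) ≡ toℕ i
    portOf-dartAt v i = trans (portOf-from (proj₂ (Inverse.to (ports v) i)))
                              (cong toℕ (Inverse.strictlyInverseʳ (ports v) i))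

    naming : Naming G M P
    naming = record
      { key = key ; key-injective = key-injective ; port = λ h → toPort (portOf h)
      ; port-injective = λ {h} {h′} t p → unique t (toPort-injective (portOf h) (portOf h′) p) }
      where
      unique : ∀ {h h′} → tail G h ≡ tail G h′ → toℕ (portOf h) ≡ toℕ (portOf h′) → h ≡ h′
      unique {h} {h′} t p = trans (sym (cong proj₁ (Inverse.strictlyInverseˡ (ports v) (h , t))))
        (trans (cong (dartAt v) (toℕ-injective (trans (sym (portOf-from t)) p))) (dartAt-portOf h′))
        where v = tail G h′

  -- What the views contain during an execution

  module Run {G : Multigraph} (N : Network G s) (deg≤Δ : ∀ v → degree G v ≤ Δ) (ω : Outcome G (T * B)) where
    open Multigraph G
    open Network N using (ports; dartAt; portOf)
    open Names N deg≤Δ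
    open Naming naming using (port; name; IsPeers)

    view : ℕ → Vertex G → View′
    view = Execution.state N algorithm ω

    neighbour : ℕ → ∀ v → Fin (degree G v) → Fin P × View′
    neighbour τ v i = port (reverse G (dartAt v i)) , view τ (head G (dartAt v i))

    view-suc : ∀ τ v → view (suc τ) v ≡ round (view τ v) (List.tabulate (neighbour τ v))
    view-suc τ v = cong (round (view τ v)) (List.tabulate-cong λ i →
      trans (lookup∘tabulate _ i) (lookup∘tabulate _ (portOf (reverse G (dartAt v i)))))

    ownKey-view : ∀ τ v → ownKey (view τ v) ≡ key v
    ownKey-view zero    v = refl
    ownKey-view (suc τ) v = ownKey-view τ v

    ownBits-view : ∀ τ v → ownBits (view τ v) ≡ lookup ω v
    ownBits-view zero    v = refl
    ownBits-view (suc τ) v = ownBits-view τ v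

    received-view : ∀ τ v → received (view (suc τ) v) ≡ List.tabulate (neighbour τ v)
    received-view τ v = cong received (view-suc τ v)

    peers-view : ∀ τ v → IsPeers v (peers (view (suc τ) v))
    peers-view τ v = at-dart , only-darts
      where
      open ≡-Reasoning
      toName-neighbour : ∀ i → toName (neighbour τ v i) ≡ name (reverse G (dartAt v i))
      toName-neighbour i = cong (_, port (reverse G (dartAt v i))) (ownKey-view τ (head G (dartAt v i)))
      lookup-peers : ∀ p → lookup (peers (view (suc τ) v)) p ≡ peerAt (List.tabulate (neighbour τ v)) p
      lookup-peers p = trans (lookup∘tabulate (peerAt (received (view (suc τ) v))) p)
                             (cong (λ ms → peerAt ms p) (received-view τ v))
      toℕ-port : ∀ h → toℕ (port h) ≡ toℕ (portOf h)
      toℕ-port h = toℕ-mod (≤-trans (toℕ<n (portOf h)) (≤-trans (deg≤Δ (tail G h)) (n≤1+n Δ)))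
      at-dart : ∀ h → tail G h ≡ v → lookup (peers (view (suc τ) v)) (port h) ≡ just (name (reverse G h))
      at-dart h refl = begin
        lookup (peers (view (suc τ) v)) (port h)
          ≡⟨ lookup-peers (port h) ⟩
        Maybe.map toName (nth (List.tabulate (neighbour τ v)) (toℕ (port h)))
          ≡⟨ cong (λ j → Maybe.map toName (nth (List.tabulate (neighbour τ v)) j)) (toℕ-port h) ⟩
        Maybe.map toName (nth (List.tabulate (neighbour τ v)) (toℕ (portOf h)))
          ≡⟨ cong (Maybe.map toName) (nth-tabulate (neighbour τ v) (portOf h)) ⟩
        just (toName (neighbour τ v (portOf h)))
          ≡⟨ cong just (toName-neighbour (portOf h)) ⟩
        just (name (reverse G (dartAt v (portOf h))))
          ≡⟨ cong (just ∘ name ∘ reverse G) (dartAt-portOf h) ⟩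
        just (name (reverse G h)) ∎
      only-darts : ∀ p nm → lookup (peers (view (suc τ) v)) p ≡ just nm →
                   ∃[ h ] tail G h ≡ v × port h ≡ p × name (reverse G h) ≡ nm
      only-darts p nm eq with nth (List.tabulate (neighbour τ v)) (toℕ p) in eq′
                            | trans (sym (lookup-peers p)) eq
      ... | just x | refl with i , same , refl ← nth-tabulate⁻ (neighbour τ v) (toℕ p) eq′ =
        dartAt v i , proj₂ (Inverse.to (ports v) i) ,
        toℕ-injective (trans (toℕ-port (dartAt v i)) (trans (portOf-dartAt v i) same)) ,
        sym (toName-neighbour i)

    module _ {A : Set} (f : View′ → A) where

      flood-sound : ∀ i τ x {z a} → flood i f (view (i + τ) x) z ≡ just a →
                    ∃[ y ] key y ≡ z × f (view τ y) ≡ a × Within G i x y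
      flood-sound zero τ x {z} eq with z ≟ ownKey (view τ x)
      flood-sound zero τ x {z} refl | yes same = x , trans (sym (ownKey-view τ x)) (sym same) , refl , stay
      flood-sound (suc i) τ x {z} eq
        with <∣>-just (flood i f (view (i + τ) x) z) _ eq
      ... | inj₁ eq′ with y , k , a , w ← flood-sound i τ x eq′ = y , k , a , Within-mono G (n≤1+n i) w
      ... | inj₂ eq′ with (q , u) , u∈ , eq″ ← firstJust⁻ {A = Fin P × View′} (λ (_ , u) → flood i f u z) _ eq′
        with j , refl ← ∈-tabulate⁻ (subst ((q , u) ∈_) (received-view (i + τ) x) u∈)
        with y , k , a , w ← flood-sound i τ (head G (dartAt x j)) eq″ =
        y , k , a , subst (λ x → Within G (suc i) x y) (proj₂ (Inverse.to (ports x) j)) (move (dartAt x j) w)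

      flood-defined : ∀ i τ {x y} → Within G i x y → ∃ λ a → flood i f (view (i + τ) x) (key y) ≡ just a
      flood-defined zero τ {x} stay with key x ≟ ownKey (view τ x)
      ... | yes _ = _ , refl
      ... | no ≢  = ⊥-elim (≢ (sym (ownKey-view τ x)))
      flood-defined (suc i) τ {x} stay =
        <∣>-justˡ (flood i f (view (i + τ) x) (key x)) _ (flood-defined i τ stay)
      flood-defined (suc i) τ {y = y} (move h w) =
        <∣>-justʳ (flood i f (view (i + τ) (tail G h)) (key y)) _
          (firstJust⁺ {A = Fin P × View′} (λ (_ , u) → flood i f u (key y))
            (subst (neighbour (i + τ) (tail G h) (portOf h) ∈_) (sym (received-view (i + τ) (tail G h)))
              (∈-tabulate⁺ (portOf h)))
            (subst (λ g → ∃ λ a → flood i f (view (i + τ) (head G g)) (key y) ≡ just a)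
              (sym (dartAt-portOf h)) (flood-defined i τ w)))

      -- Some answer exists, and by `flood-sound` every answer comes from the vertex with this key
      -- in round τ. Hence it does not matter which one is met first.
      flood-complete : ∀ i τ {x y} → Within G i x y → flood i f (view (i + τ) x) (key y) ≡ just (f (view τ y))
      flood-complete i τ {x} w with a , eq ← flood-defined i τ w
        with y′ , same , refl , _ ← flood-sound i τ x eq
        with refl ← key-injective same = eq

    module Phase (t : Fin T) where

      X : Vertex G → ℕ
      X y = lead (lookup (Vec.map (slice {T} t) ω) y)

      X≤B : ∀ y → X y ≤ B
      X≤B y = lead≤ (lookup (Vec.map (slice {T} t) ω) y)

      radius-view : ∀ τ y → radius t (view τ y) ≡ X y
      radius-view τ y = cong lead (trans (cong (slice {T} t) (ownBits-view τ y)) (sym (lookup-map y (slice {T} t) ω)))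

      Cov : Vertex G → Pred (Fin M) 0ℓ
      Cov = Covered G key D X

      distance-split : ∀ {j} τ → j ≤ B → j * D + (B * D ∸ j * D + τ) ≡ B * D + τ
      distance-split {j} τ j≤B = trans (sym (+-assoc (j * D) _ τ)) (cong (_+ τ) (m+[n∸m]≡n (*-monoˡ-≤ D j≤B)))

      coveredBy⇒ : ∀ τ x z → CoveredBy t (view (B * D + τ) x) z → Cov x z
      coveredBy⇒ τ x z (j , eq)
        with y , same , r , w ← flood-sound (radius t) (toℕ j * D) (B * D ∸ toℕ j * D + τ) x
               (subst (λ σ → flood (toℕ j * D) (radius t) (view σ x) z ≡ just (toℕ j)) (sym (distance-split τ (≤-pred (toℕ<n j)))) eq)
        = y , same , subst (λ X → Within G (X * D) x y) (trans (sym r) (radius-view (B * D ∸ toℕ j * D + τ) y)) w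

      coveredBy⇐ : ∀ τ x z → Cov x z → CoveredBy t (view (B * D + τ) x) z
      coveredBy⇐ τ x z (y , refl , w) = Fin.fromℕ< (s≤s (X≤B y)) ,
        subst (λ j → flood (j * D) (radius t) (view (B * D + τ) x) (key y) ≡ just j) (sym (toℕ-fromℕ< _))
          (trans (subst (λ σ → flood (X y * D) (radius t) (view σ x) (key y) ≡ just (radius t (view τ′ y))) (distance-split τ (X≤B y))
                   (flood-complete (radius t) (X y * D) τ′ w))
                 (cong just (radius-view τ′ y)))
        where
        τ′ = B * D ∸ X y * D + τ

      -- The decision procedure required by `least-exists` is the test of the algorithm itself, on
      -- views of depth `B * D`. Every vertex is covered by its own ball.
      has-center : ∀ x → ∃ (IsLeast (Cov x))
      has-center x with z , c , below ← least-exists (coveredBy? t (view (B * D + 0) x))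
                                          (key x , coveredBy⇐ 0 x (key x) (x , refl , stay)) =
        z , coveredBy⇒ 0 x z c , λ z′ lt c′ → below z′ lt (coveredBy⇐ 0 x z′ c′)

      Z : Vertex G → Fin M
      Z x = proj₁ (has-center x)

      center-view : ∀ {τ} → B * D ≤ τ → ∀ x {z} → IsLeast (Cov x) z → center t (view τ x) ≡ just z
      center-view {τ} le x {z} (c , below) =
        subst (λ τ → center t (view τ x) ≡ just z) (m+[n∸m]≡n le)
          (least-correct (coveredBy? t (view (B * D + σ) x))
            (coveredBy⇐ σ x z c , λ z′ lt c′ → below z′ lt (coveredBy⇒ σ x z′ c′)))
        where σ = τ ∸ B * D

      Z-unique : ∀ x {z} → IsLeast (Cov x) z → Z x ≡ z
      Z-unique x l = Maybe.just-injective (trans (sym (center-view ≤-refl x (proj₂ (has-center x)))) (center-view ≤-refl x l))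

      InCluster : Vertex G → Pred (Vertex G) 0ℓ
      InCluster v u = Z u ≡ Z v

      inCluster? : ∀ v → Decidable (InCluster v)
      inCluster? v u = Z u ≟ Z v

      common-center : ∀ {v u z} → Cov v z → Cov u z → Within G W v u
      common-center (y , refl , w) (y′ , k , w′) with refl ← key-injective k =
        Within-trans G (Within-mono G (*-monoˡ-≤ D (X≤B y)) w)
                       (Within-sym G (Within-mono G (*-monoˡ-≤ D (X≤B y)) w′))

      cluster-diameter : ∀ {v u} → InCluster v u → Within G W v u
      cluster-diameter {v} {u} same = common-center (proj₁ (proj₂ (has-center v)))
        (subst (Cov u) same (proj₁ (proj₂ (has-center u))))

      module _ (lab : View′ → Vec Bool P) {τ : ℕ} (deep : B * D ≤ τ) where

        entry : Vertex G → Entry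
        entry u = peers (view τ u) , lab (view τ u)

        clusterOf : Vertex G → Cluster
        clusterOf v = cluster t lab (view (W + τ) v)

        center-here : ∀ v → center t (view (W + τ) v) ≡ just (Z v)
        center-here v = center-view (≤-trans deep (m≤n+m τ W)) v (proj₂ (has-center v))

        lookup-cluster : ∀ v z → lookup (clusterOf v) z ≡
                         sameCluster (just (Z v)) (flood W (info t lab) (view (W + τ) v) z)
        lookup-cluster v z = trans (lookup∘tabulate (clusterAt t lab (view (W + τ) v)) z)
          (cong (λ c → sameCluster c (flood W (info t lab) (view (W + τ) v) z)) (center-here v))

        cluster-present : ∀ v u → InCluster v u → lookup (clusterOf v) (key u) ≡ just (entry u)
        cluster-present v u same = trans (lookup-cluster v (key u))
          (trans (cong (sameCluster (just (Z v))) (flood-complete (info t lab) W τ (cluster-diameter same)))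
                 (sameCluster-yes (trans (center-view deep u (proj₂ (has-center u))) (cong just same))))

        cluster-only : ∀ v z e → lookup (clusterOf v) z ≡ just e → ∃[ u ] InCluster v u × key u ≡ z
        cluster-only v z e eq = member (flood-sound (info t lab) W τ v
            (sameCluster⁻ (just (Z v)) _ (trans (sym (lookup-cluster v z)) eq)))
          where
          member : (∃[ u ] key u ≡ z × info t lab (view τ u) ≡ (just (Z v) , e) × Within G W v u) →
                   ∃[ u ] InCluster v u × key u ≡ z
          member (u , k , i , _) =
            u , Maybe.just-injective (trans (sym (center-view deep u (proj₂ (has-center u)))) (cong proj₁ i)) , k

        -- An entry of either table belongs to a member of the common cluster, and both tables
        -- record every member as of the same round τ.
        cluster-cong : ∀ {v v′} → InCluster v v′ → clusterOf v ≡ clusterOf v′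
        cluster-cong {v} {v′} same = begin
          clusterOf v                       ≡⟨ tabulate∘lookup (clusterOf v) ⟨
          tabulate (lookup (clusterOf v))   ≡⟨ tabulate-cong (λ z → Maybe-ext (transfer (sym same) z) (transfer same z)) ⟩
          tabulate (lookup (clusterOf v′))  ≡⟨ tabulate∘lookup (clusterOf v′) ⟩
          clusterOf v′                      ∎
          where
          open ≡-Reasoning
          transfer : ∀ {v v′} → Z v ≡ Z v′ → ∀ z e → lookup (clusterOf v) z ≡ just e → lookup (clusterOf v′) z ≡ just e
          transfer {v} {v′} same z e eq = move-entry (cluster-only v z e eq)
            where
            move-entry : (∃[ u ] InCluster v u × key u ≡ z) → lookup (clusterOf v′) z ≡ just e
            move-entry (u , c , refl) =
              trans (cluster-present v′ u (trans c same)) (trans (sym (cluster-present v u c)) eq)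

        describes : ∀ {δ} → τ ≡ suc δ → ∀ v →
                    Describes naming (clusterOf v) (InCluster v) (λ u → lab (view τ u))
        describes {δ} depth>0 v = record
          { peersOf = λ u → peers (view τ u)
          ; isPeers = λ u → subst (λ i → IsPeers u (peers (view i u))) (sym depth>0) (peers-view δ u)
          ; present = cluster-present v
          ; only    = cluster-only v }

-- Correctness of the algorithm

module Correctness (s Δ k m J T B : ℕ) where

  -- Growth by a factor 1 + 1/(m+1) gives 2^J in (m+1) J steps; the last step is for
  -- the other end of the edge to be oriented.
  R : ℕ
  R = suc (suc m * J)

  open Algorithm s Δ k R T B

  module _ {G : Multigraph} (N : Network G s) (deg≤Δ : ∀ v → degree G v ≤ Δ) {a : ℕ}
           (parts : PartitionsIntoPseudoForests G a) (a≤k : a * suc (suc m) ≤ k * suc m)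
           (V<2^J : Multigraph.#V G < 2 ^ J) (0<B : Vertex G → 0 < B) (ω : Outcome G (T * B)) where
    open Multigraph G
    open Names N deg≤Δ
    open Run N deg≤Δ ω
    open Naming naming using (port; name)
    open ClusterProblem M P

    labelOf : List (Fin T) → Vertex G → Vec Bool P
    labelOf ts v = label ts (view (depth ts) v)

    labellingAfter : List (Fin T) → Labelling G
    labellingAfter ts = labellingOf naming (labelOf ts)

    deep : ∀ ts → B * D ≤ depth ts
    deep []       = ≤-refl
    deep (t ∷ ts) = ≤-trans (deep ts) (m≤n+m (depth ts) W)

    depth-suc : ∀ ts → Vertex G → ∃[ δ ] depth ts ≡ suc δ
    depth-suc ts v = positive (≤-trans (*-mono-≤ (0<B v) (s≤s z≤n)) (deep ts))
      where
      positive : ∀ {i} → 0 < i → ∃[ δ ] i ≡ suc δ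
      positive (s≤s _) = _ , refl

    module Step (t : Fin T) (ts : List (Fin T)) (partial : Partial G k (labellingAfter ts)) where
      open Phase t
      open Partial

      private
        ℓ ℓ⁺ : Labelling G
        ℓ  = labellingAfter ts
        ℓ⁺ = labellingAfter (t ∷ ts)

      c : Vertex G → Cluster
      c = clusterOf (label ts) (deep ts)

      m⁺ : Vertex G → Labels
      m⁺ v = solve k R (c v)

      described : ∀ v → Describes naming (c v) (InCluster v) (labelOf ts)
      described v = describes (label ts) (deep ts) (proj₂ (depth-suc ts v)) v

      solved : ∀ v → Acceptable k R (c v) (m⁺ v)
      solved v = solve-correct naming (inCluster? v) (described v) k parts a≤k J V<2^J partial

      labelOf-step : ∀ v u → InCluster v u → labelOf (t ∷ ts) u ≡ lookup (m⁺ v) (key u)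
      labelOf-step v u same = cong₂ (λ c x → lookup (solve k R c) x)
        (sym (cluster-cong (label ts) (deep ts) same)) (ownKey-view (depth (t ∷ ts)) u)

      at-step : ∀ v h → InCluster v (tail G h) → ℓ⁺ h ≡ at (m⁺ v) (name h)
      at-step v h same = cong (λ l → lookup l (port h)) (labelOf-step v (tail G h) same)

      Oriented⇐ : ∀ h → InCluster (tail G h) (head G h) →
                  at (m⁺ (tail G h)) (name h) ≡ true ⊎ at (m⁺ (tail G h)) (name (reverse G h)) ≡ true →
                  Oriented G ℓ⁺ h
      Oriented⇐ h same = Sum.map (trans (at-step (tail G h) h refl)) (trans (at-step (tail G h) (reverse G h) same))

      unchanged : ∀ h → ¬ InCluster (tail G h) (head G h) → ℓ⁺ h ≡ ℓ h
      unchanged h ∉ = trans (at-step (tail G h) h refl)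
        (acceptable-leaving naming (inCluster? (tail G h)) (described (tail G h)) k R (solved (tail G h)) h refl ∉)

      unchanged-reverse : ∀ h → ¬ InCluster (tail G h) (head G h) → ℓ⁺ (reverse G h) ≡ ℓ (reverse G h)
      unchanged-reverse h ∉ = unchanged (reverse G h)
        (λ same → ∉ (trans (sym same) (cong (Z ∘ tail G) (reverse-reverse G h))))

      -- The two halves of an edge inside a cluster are labelled by the same solution; those of an
      -- edge between clusters both keep their labels.
      partial-step : Partial G k ℓ⁺
      partial-step = record { exclusive = excl ; bounded = bound }
        where
        excl : ∀ h → ℓ⁺ h ≡ true → ℓ⁺ (reverse G h) ≢ true
        excl h o o′ = split (inCluster? (tail G h) (head G h))
          where
          split : Dec (InCluster (tail G h) (head G h)) → ⊥
          split (yes same) = acceptable-exclusive naming (inCluster? (tail G h)) (described (tail G h)) k R (solved (tail G h)) h refl same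
                           (trans (sym (at-step (tail G h) h refl)) o)
                           (trans (sym (at-step (tail G h) (reverse G h) same)) o′)
          split (no ∉) = exclusive partial h (trans (sym (unchanged h ∉)) o) (trans (sym (unchanged-reverse h ∉)) o′)
        bound : ∀ v → outdegree G ℓ⁺ v ≤ k
        bound v = ≤-trans (outdegree-labellingOf naming (labelOf (t ∷ ts)) v)
          (subst (λ l → length (filter (λ p → lookup l p Bool.≟ true) (allFin P)) ≤ k) (sym (labelOf-step v v refl))
            (acceptable-bounded naming (inCluster? v) (described v) k R (solved v) v))

      keeps-step : ∀ h → Oriented G ℓ h → Oriented G ℓ⁺ h
      keeps-step h o = split (inCluster? (tail G h) (head G h))
        where
        split : Dec (InCluster (tail G h) (head G h)) → Oriented G ℓ⁺ h
        split (yes same) = Oriented⇐ h same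
              (acceptable-keeps naming (inCluster? (tail G h)) (described (tail G h)) k R (solved (tail G h)) h refl same o)
        split (no ∉) = Sum.map (trans (unchanged h ∉)) (trans (unchanged-reverse h ∉)) o

      orients-step : ∀ h → Closed G k (inCluster? (tail G h)) R (tail G h) → Oriented G ℓ⁺ h
      orients-step h cl = Oriented⇐ h same
        (acceptable-orients naming (inCluster? (tail G h)) (described (tail G h)) k R (solved (tail G h)) h refl same cl)
        where
        same : InCluster (tail G h) (head G h)
        same = Closed⇒T G k (inCluster? (tail G h)) (suc m * J) (proj₂ cl h refl)

    partial-after : ∀ ts → Partial G k (labellingAfter ts)
    partial-after [] = record
      { exclusive = λ h o → ⊥-elim (unlabelled h o)
      ; bounded   = λ v → subst (_≤ k) (sym (trans (outdegree-∑ G (labellingAfter []) v)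
                      (∑-none (darts G) (owned? G (labellingAfter []) v) (All.tabulate λ {h} _ (_ , o) → unlabelled h o)))) z≤n }
      where
      unlabelled : ∀ h → labellingAfter [] h ≢ true
      unlabelled h o = false≢true (trans (sym (lookup-replicate (port h) false)) o)
    partial-after (t ∷ ts) = Step.partial-step t ts (partial-after ts)

    Unpadded : Fin T → Vertex G → Set
    Unpadded t v = Fails key key-injective (Near? G key key-injective R v) (Near-suc G key key-injective R v)
                         (Vec.map (slice {T} t) ω)

    padded-closed : ∀ t v → ¬ Unpadded t v → Closed G k (Phase.inCluster? t v) R v
    padded-closed t v ¬f with z , centre ← padded G key key-injective R v (Vec.map (slice {T} t) ω) ¬f =
      Within⇒Closed G k (inCluster? v) R v λ u w →
        trans (Z-unique u (centre u w)) (sym (Z-unique v (centre v stay)))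
      where open Phase t

    oriented-after : ∀ ts h t → t ∈ ts → ¬ Unpadded t (tail G h) → Oriented G (labellingAfter ts) h
    oriented-after (t ∷ ts) h _ (here refl) ¬f = Step.orients-step t ts (partial-after ts) h (padded-closed t (tail G h) ¬f)
    oriented-after (t ∷ ts) h t′ (there t′∈) ¬f =
      Step.keeps-step t ts (partial-after ts) h (oriented-after ts h t′ t′∈ ¬f)

    rounds : ℕ
    rounds = depth (allFin T)

    output-labelling : ∀ h → Execution.labelling N algorithm ω rounds h ≡ labellingAfter (allFin T) h
    output-labelling h = lookup∘tabulate (λ i → lookup (labelOf (allFin T) (tail G h)) (toPort i)) (Network.portOf N h)

    obtains-orientation : (∀ v → ∃[ t ] ¬ Unpadded t v) →
                          _-IsOrientation_ G k (Execution.labelling N algorithm ω rounds)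
    obtains-orientation good = orientation , bound
      where
      open Partial (partial-after (allFin T))
      ℓ = labellingAfter (allFin T)
      out = Execution.labelling N algorithm ω rounds
      opposite : ∀ e → Oriented G ℓ (e , false) → ℓ (e , true) ≡ not (ℓ (e , false))
      opposite e o with ℓ (e , false) in eq | ℓ (e , true) in eq′
      ... | true  | true  = ⊥-elim (exclusive (e , false) eq eq′)
      ... | true  | false = refl
      ... | false | true  = refl
      opposite e (inj₁ ()) | false | false
      opposite e (inj₂ ()) | false | false
      orientation : IsOrientation G out
      -- It is enough that one end of the edge is padded in some phase.
      orientation e = trans (output-labelling (e , true))
        (trans (opposite e (let (t , ¬f) = good (tail G (e , false)) in oriented-after (allFin T) (e , false) t (∈-allFin t) ¬f))
               (cong not (sym (output-labelling (e , false)))))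
      bound : ∀ v → outdegree G out v ≤ k
      bound v = begin
        outdegree G out v                      ≡⟨ outdegree-∑ G out v ⟩
        ∑ (darts G) (λ h → 𝟙 (owned? G out v h)) ≤⟨ ∑-mono (darts G) (λ h → 𝟙-mono (owned? G out v h) (owned? G ℓ v h)
                                                      (λ (t , o) → t , trans (sym (output-labelling h)) o)) ⟩
        ∑ (darts G) (λ h → 𝟙 (owned? G ℓ v h))   ≡⟨ outdegree-∑ G ℓ v ⟨
        outdegree G ℓ v                        ≤⟨ bounded v ⟩
        k                                      ∎
        where open ≤-Reasoning

-- Real and integer arithmetic

-- `fromℕ` normalises by a gcd and does not compute on a variable; this is the same rational given
-- in lowest terms.
int : ℕ → ℚ
int n = mkℚ (ℤ.+ n) 0 (Coprime.sym (Coprime.1-coprimeTo n))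

fromℕ≡int : ∀ n → fromℕ n ≡ int n
fromℕ≡int n = ℚ.normalize-coprime (Coprime.sym (Coprime.1-coprimeTo n))

1/suc : ℕ → ℚ
1/suc n = mkℚ (ℤ.+ 1) n (Coprime.1-coprimeTo (suc n))

int-mono : ∀ {m n} → m ≤ n → int m ℚ.≤ int n
int-mono {m} {n} m≤n = ℚ.*≤* (subst₂ ℤ._≤_ (sym (ℤ.*-identityʳ (ℤ.+ m))) (sym (ℤ.*-identityʳ (ℤ.+ n))) (ℤ.+≤+ m≤n))

int-* : ∀ m n → int (m * n) ≡ int m ℚ.* int n
int-* m n = ℚ.toℚᵘ-injective (ℚᵘ.≃-trans (ℚᵘ.*≡* (cong (ℤ._* ℤ.1ℤ) (ℤ.pos-* m n)))
                                         (ℚᵘ.≃-sym (ℚ.toℚᵘ-homo-* (int m) (int n))))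

1/suc-<-positive : ∀ q → ℚ.0ℚ ℚ.< q → ∃[ n ] 1/suc n ℚ.< q
1/suc-<-positive (mkℚ (ℤ.+ suc p) d _) _ = suc d , ℚ.*<* (ℤ.+<+ (s≤s (s≤s (≤-trans (≤-reflexive (+-identityʳ d)) (m≤m+n d _)))))
1/suc-<-positive (mkℚ (ℤ.+ zero) d _)  lt with () ← ℚ.positive lt
1/suc-<-positive (mkℚ ℤ.-[1+ n ] d _)  lt with () ← ℚ.positive lt

1/suc-decreasing : ∀ n → 1/suc (suc n) ℚ.< 1/suc n
1/suc-decreasing n = ℚ.*<* (ℤ.+<+ (s≤s (s≤s ≤-refl)))

module _ (ε : ℝ) where
  open ℝ ε

  L-down : ∀ {p q} → p ℚ.< q → L q → L p
  L-down p<q l = Equivalence.from (L-rounded _) (_ , p<q , l)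

  U-up : ∀ {p q} → p ℚ.< q → U p → U q
  U-up p<q u = Equivalence.from (U-rounded _) (_ , p<q , u)

  L≤U : ∀ {p q} → L p → U q → p ℚ.≤ q
  L≤U l u = ℚ.≮⇒≥ λ q<p → disjoint _ (l , U-up q<p u)

  -- Comparisons with ε being undecidable, 1/ε is only located up to a factor 3.
  reciprocal : InUnitInterval ε → ∃[ μ ] L (1/suc (suc (suc μ))) × U (1/suc μ)
  reciprocal (l₀ , u₁) with q , 0<q , l ← Equivalence.to (L-rounded ℚ.0ℚ) l₀
    with N , lt ← 1/suc-<-positive q 0<q = search N 0 (+-identityʳ N) u₁
    where
    search : ∀ fuel μ → fuel + μ ≡ N → U (1/suc μ) → ∃[ μ ] L (1/suc (suc (suc μ))) × U (1/suc μ)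
    -- By the choice of `N`, `1/suc N` lies below `ε`, so the search stops before `μ` gets there.
    search zero μ refl u = ⊥-elim (disjoint _ (L-down lt l , u))
    search (suc fuel) μ eq u with located _ _ (1/suc-decreasing (suc μ))
    ... | inj₁ l′ = μ , l′ , u
    ... | inj₂ u′ = search fuel (suc μ) (trans (+-suc fuel μ) eq) u′

  ≤/ε : ∀ {r x μ} → U (1/suc μ) → r ≤ x * suc μ → r ≤[ x / ε ]
  ≤/ε {r} {x} {μ} u r≤ q l rewrite fromℕ≡int r | fromℕ≡int x with ℚ.≤-total q ℚ.0ℚ
  ... | inj₁ q≤0 = begin
    int r ℚ.* q      ≤⟨ ℚ.*-monoˡ-≤-nonNeg (int r) q≤0 ⟩
    int r ℚ.* ℚ.0ℚ   ≡⟨ ℚ.*-zeroʳ (int r) ⟩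
    ℚ.0ℚ             ≤⟨ int-mono z≤n ⟩
    int x            ∎
    where open ℚ.≤-Reasoning
  ... | inj₂ 0≤q = begin
    int r ℚ.* q                    ≤⟨ ℚ.*-monoʳ-≤-nonNeg q {{ℚ.nonNegative 0≤q}} (int-mono r≤) ⟩
    int (x * suc μ) ℚ.* q          ≡⟨ cong (ℚ._* q) (int-* x (suc μ)) ⟩
    int x ℚ.* int (suc μ) ℚ.* q    ≡⟨ ℚ.*-assoc (int x) (int (suc μ)) q ⟩
    int x ℚ.* (int (suc μ) ℚ.* q)  ≤⟨ ℚ.*-monoˡ-≤-nonNeg (int x) (ℚ.*-monoˡ-≤-nonNeg (int (suc μ)) (L≤U l u)) ⟩
    int x ℚ.* (int (suc μ) ℚ.* 1/suc μ) ≡⟨ cong (int x ℚ.*_) (ℚ.*-inverseʳ (int (suc μ))) ⟩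
    int x ℚ.* ℚ.1ℚ                 ≡⟨ ℚ.*-identityʳ (int x) ⟩
    int x                          ∎
    where open ℚ.≤-Reasoning

  -- The instance 1/(m+1) of the bound. Unnormalised rationals add and multiply without gcds, which
  -- leaves an inequality between integers.
  *1+⇒ : ∀ {a k m} → L (1/suc m) → [ a *1+ ε ]≤ k → a * suc (suc m) ≤ k * suc m
  *1+⇒ {a} {k} {m} l bound = subst (_≤ k * suc m) (*-identityʳ _) (ℤ.drop‿+≤+ (subst₂ ℤ._≤_ left right (ℚᵘ.drop-*≤* unnormalised)))
    where
    unnormalised : mkℚᵘ (ℤ.+ a) 0 ℚᵘ.* (mkℚᵘ (ℤ.+ 1) 0 ℚᵘ.+ mkℚᵘ (ℤ.+ 1) m) ℚᵘ.≤ mkℚᵘ (ℤ.+ k) 0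
    unnormalised = ℚᵘ.≤-respˡ-≃
      (ℚᵘ.≃-trans (ℚ.toℚᵘ-homo-* (int a) (ℚ.1ℚ ℚ.+ 1/suc m))
                  (ℚᵘ.*-congˡ {mkℚᵘ (ℤ.+ a) 0} (ℚ.toℚᵘ-homo-+ ℚ.1ℚ (1/suc m))))
      (ℚ.toℚᵘ-mono-≤ (subst₂ (λ a k → a ℚ.* (ℚ.1ℚ ℚ.+ 1/suc m) ℚ.≤ k) (fromℕ≡int a) (fromℕ≡int k) (bound _ l)))
    left : (ℤ.+ a ℤ.* (ℤ.+ 1 ℤ.* ℤ.+ suc m ℤ.+ ℤ.+ 1 ℤ.* ℤ.+ 1)) ℤ.* ℤ.+ 1 ≡ ℤ.+ (a * suc (suc m) * 1)
    left = trans (cong (λ x → (ℤ.+ a ℤ.* (ℤ.+ x)) ℤ.* ℤ.+ 1) (solve 1 (λ m → (con 1 :+ (m :+ con 0)) :+ con 1 := con 2 :+ m) refl m))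
                 (trans (cong (ℤ._* ℤ.+ 1) (sym (ℤ.pos-* a (suc (suc m))))) (sym (ℤ.pos-* (a * suc (suc m)) 1)))
      where open +-*-Solver
    right : ℤ.+ k ℤ.* ℤ.+ (suc ((m + 0) + 0)) ≡ ℤ.+ (k * suc m)
    right = trans (sym (ℤ.pos-* k _)) (cong (λ x → ℤ.+ (k * suc x)) (trans (+-identityʳ _) (+-identityʳ m)))

≤2^⌈log₂⌉ : ∀ n → n ≤ 2 ^ ⌈log₂ n ⌉
≤2^⌈log₂⌉ = <-rec (λ n → n ≤ 2 ^ ⌈log₂ n ⌉) step
  where
  open ≤-Reasoning
  step : ∀ n → (∀ {i} → i < n → i ≤ 2 ^ ⌈log₂ i ⌉) → n ≤ 2 ^ ⌈log₂ n ⌉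
  step zero          rec = z≤n
  step (suc zero)    rec = m^n>0 2 ⌈log₂ 1 ⌉
  step n@(suc (suc n-2)) rec = begin
    n                              ≡⟨ ⌊n/2⌋+⌈n/2⌉≡n n ⟨
    ⌊ n /2⌋ + ⌈ n /2⌉     ≤⟨ +-monoˡ-≤ ⌈ n /2⌉ (⌊n/2⌋≤⌈n/2⌉ n) ⟩
    ⌈ n /2⌉ + ⌈ n /2⌉              ≡⟨ cong (⌈ n /2⌉ +_) (+-identityʳ ⌈ n /2⌉) ⟨
    2 * ⌈ n /2⌉                    ≤⟨ *-monoʳ-≤ 2 (rec (⌈n/2⌉<n n-2)) ⟩
    2 * 2 ^ ⌈log₂ ⌈ n /2⌉ ⌉        ≡⟨ cong (λ i → 2 * 2 ^ i) (⌈log₂⌈n/2⌉⌉≡⌈log₂n⌉∸1 n) ⟩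
    2 ^ suc (⌈log₂ n ⌉ ∸ 1) ≡⟨ cong (2 ^_) (m+[n∸m]≡n {1} (⌈log₂⌉-mono-≤ {2} {n} (s≤s (s≤s z≤n)))) ⟩
    2 ^ ⌈log₂ n ⌉                  ∎

-- The failure probability

module FailureProbability (c s Δ k m J : ℕ) where

  -- Since (5/8)² ≤ 1/2, a given vertex is cut in all T phases with probability at most 2^-E.
  -- B = 3 J, not J + 2, makes the number of rounds vanish when n = 0.
  E T B : ℕ
  E = J * suc c
  T = 2 * E
  B = 3 * J

  open Correctness s Δ k m J T B
  open Algorithm s Δ k R T B

  module _ {G : Multigraph} (N : Network G s) (deg≤Δ : ∀ v → degree G v ≤ Δ) {a : ℕ}
           (parts : PartitionsIntoPseudoForests G a) (a≤k : a * suc (suc m) ≤ k * suc m)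
           (V<2^J : Multigraph.#V G < 2 ^ J) where
    open Multigraph G
    open Names N deg≤Δ

    J>0 : Vertex G → 0 < J
    J>0 v = positive J (Fin⇒0< v) V<2^J
      where
      positive : ∀ J {n} → 0 < n → n < 2 ^ J → 0 < J
      positive zero    (s≤s _) (s≤s ())
      positive (suc J) _       _ = s≤s z≤n

    B>0 : Vertex G → 0 < B
    B>0 v = *-mono-≤ {1} {3} (s≤s z≤n) (J>0 v)

    Ω : List (Outcome G (T * B))
    Ω = outcomes G (T * B)

    failsIn? : ∀ v (ω : Vec (Vec _ B) #V) →
               Dec (Fails key key-injective (Near? G key key-injective R v) (Near-suc G key key-injective R v) ω)
    failsIn? v ω = Fails? key key-injective (Near? G key key-injective R v) (Near-suc G key key-injective R v) ω

    failsAlways? : ∀ v (ω : Outcome G (T * B)) → Dec (∀ t → _)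
    failsAlways? v ω = all? {T} λ t → failsIn? v (Vec.map (slice {T} t) ω)

    failsAlways : Vertex G → ℕ
    failsAlways v = ∑ Ω (λ ω → 𝟙 (failsAlways? v ω))

    open ≤-Reasoning
    open +-*-Solver

    phase-failure : ∀ v → 8 * ∑ (allVecs (bits B) #V) (λ ω → 𝟙 (failsIn? v ω)) ≤ 5 * length (allVecs (bits B) #V)
    phase-failure v = fails≤5/8 key key-injective (Near? G key key-injective R v) (Near-suc G key key-injective R v) B (begin
      4 * #V      ≤⟨ *-monoʳ-≤ 4 (<⇒≤ V<2^J) ⟩
      4 * 2 ^ J   ≡⟨ *-assoc 2 2 (2 ^ J) ⟩
      2 ^ (2 + J) ≤⟨ ^-monoʳ-≤ 2 (≤-trans (+-monoˡ-≤ J (*-monoʳ-≤ 2 (J>0 v)))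
                                          (≤-reflexive (solve 1 (λ J → con 2 :* J :+ J := con 3 :* J) refl J))) ⟩
      2 ^ B       ∎)

    vertex-failure : ∀ v → 2 ^ E * failsAlways v ≤ length Ω
    vertex-failure v = *-cancelˡ-≤ (25 ^ E) {{m^n≢0 25 E}} (begin
      25 ^ E * (2 ^ E * failsAlways v)  ≡⟨ *-assoc (25 ^ E) (2 ^ E) (failsAlways v) ⟨
      25 ^ E * 2 ^ E * failsAlways v    ≡⟨ cong (_* failsAlways v) (*-^ 25 2 E) ⟨
      50 ^ E * failsAlways v            ≤⟨ *-monoˡ-≤ (failsAlways v) (^-monoˡ-≤ E (m≤m+n 50 14)) ⟩
      64 ^ E * failsAlways v            ≡⟨ cong (_* failsAlways v) (^-*-assoc 8 2 E) ⟩
      8 ^ T * failsAlways v             ≤⟨ independent-phases B #V (failsIn? v) 5 8 (phase-failure v) T (failsAlways? v) (λ _ f → f) ⟩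
      5 ^ T * length Ω                  ≡⟨ cong (_* length Ω) (^-*-assoc 5 2 E) ⟨
      25 ^ E * length Ω                 ∎)

    module _ {n : ℕ} (n≤2^J : n ≤ 2 ^ J) where

      -- Since E = J (c + 1), the failure bound 2^-E pays for both the union bound over fewer than
      -- 2^J vertices and the factor n^c ≤ 2^(J c).
      obtains : ObtainsOrientation N algorithm (depth (allFin T)) k n c
      obtains = *-cancelˡ-≤ (2 ^ J) {{m^n≢0 2 J}} (begin
        2 ^ J * (n ^ c * length (filter (¬? ∘ P?) Ω))
          ≤⟨ *-monoʳ-≤ (2 ^ J) (*-mono-≤ (^-monoˡ-≤ c n≤2^J) bad) ⟩
        2 ^ J * ((2 ^ J) ^ c * total)
          ≡⟨ *-assoc (2 ^ J) ((2 ^ J) ^ c) total ⟨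
        (2 ^ J) ^ suc c * total
          ≡⟨ cong (_* total) (^-*-assoc 2 J (suc c)) ⟩
        2 ^ E * total
          ≡⟨ ∑-*ˡ (allFin #V) (2 ^ E) failsAlways ⟨
        ∑ (allFin #V) (λ v → 2 ^ E * failsAlways v)
          ≤⟨ ∑-mono (allFin #V) vertex-failure ⟩
        ∑ (allFin #V) (λ _ → length Ω)
          ≡⟨ ∑-const (allFin #V) (length Ω) ⟩
        length (allFin #V) * length Ω
          ≡⟨ cong (_* length Ω) (List.length-tabulate {n = #V} id) ⟩
        #V * length Ω
          ≤⟨ *-monoˡ-≤ (length Ω) (<⇒≤ V<2^J) ⟩
        2 ^ J * length Ω ∎)
        where
        P? : ∀ ω → Dec (_-IsOrientation_ G k (Execution.labelling N algorithm ω (depth (allFin T))))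
        P? ω = _-isOrientation?_ G k (Execution.labelling N algorithm ω (depth (allFin T)))
        total : ℕ
        total = ∑ (allFin #V) failsAlways
        culprit : ∀ ω → ¬ (_-IsOrientation_ G k (Execution.labelling N algorithm ω (depth (allFin T)))) →
                  1 ≤ ∑ (allFin #V) (λ v → 𝟙 (failsAlways? v ω))
        culprit ω ¬p = search (any? λ v → failsAlways? v ω)
          where
          search : Dec (∃ λ v → ∀ t → _) → _
          search (yes (v , f)) = ≤-trans (≤-reflexive (sym (𝟙-yes (failsAlways? v ω) f)))
                                         (∑-∈ (λ v → 𝟙 (failsAlways? v ω)) (∈-allFin v))
          search (no ∄) = ⊥-elim (¬p (obtains-orientation N deg≤Δ parts a≤k V<2^J B>0 ω λ v →
            ¬∀⟶∃¬ T _ (λ t → failsIn? v (Vec.map (slice {T} t) ω)) (λ f → ∄ (v , f))))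
        bad : length (filter (¬? ∘ P?) Ω) ≤ total
        bad = begin
          length (filter (¬? ∘ P?) Ω)
            ≡⟨ length-filter (¬? ∘ P?) Ω ⟩
          ∑ Ω (λ ω → 𝟙 (¬? (P? ω)))
            ≤⟨ ∑-mono Ω (λ ω → 𝟙≤ (¬? (P? ω)) (culprit ω)) ⟩
          ∑ Ω (λ ω → ∑ (allFin #V) (λ v → 𝟙 (failsAlways? v ω)))
            ≡⟨ ∑-swap Ω (allFin #V) (λ ω v → 𝟙 (failsAlways? v ω)) ⟩
          total ∎

  depth≡ : ∀ ts → depth ts ≡ B * D * (1 + 2 * length ts)
  depth≡ [] = sym (*-identityʳ (B * D))
  depth≡ (t ∷ ts) rewrite depth≡ ts =
    solve 2 (λ x l → (x :+ x) :+ x :* (con 1 :+ con 2 :* l) := x :* (con 1 :+ con 2 :* (con 1 :+ l))) refl (B * D) (length ts)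
    where open +-*-Solver

-- 180 = 3 · 2 · 6 · 5: for J > 0, `B` is 3 J, `D` is 2 R with R ≤ 6 (μ+1) J, and the factor 1 + 2 T
-- = 1 + 4 J (c+1) is at most 5 J (c+1).
rounds-bound : ∀ c s Δ k μ J →
  let open FailureProbability c s Δ k (2 + μ) J
      open Correctness s Δ k (2 + μ) J T B
      open Algorithm s Δ k R T B
  in depth (allFin T) ≤ 180 * suc c * J ^ 3 * suc μ
rounds-bound c s Δ k μ J = ≤-trans
  (≤-reflexive (trans (depth≡ (allFin T)) (cong (λ l → B * (2 * R) * (1 + 2 * l)) (List.length-tabulate {n = T} id))))
  (bound J)
  where
  open FailureProbability c s Δ k (2 + μ) J
  open Correctness s Δ k (2 + μ) J T B using (R)
  open ≤-Reasoning
  open +-*-Solver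
  bound : ∀ J → 3 * J * (2 * suc ((3 + μ) * J)) * (1 + 2 * (2 * (J * suc c))) ≤ 180 * suc c * J ^ 3 * suc μ
  bound zero = z≤n
  bound J@(suc j) = begin
    3 * J * (2 * suc ((3 + μ) * J)) * (1 + 2 * (2 * (J * suc c)))
      ≤⟨ *-mono-≤ (*-monoʳ-≤ (3 * J) (*-monoʳ-≤ 2 radius≤)) (+-monoˡ-≤ (2 * (2 * (J * suc c))) (s≤s {0} z≤n)) ⟩
    3 * J * (2 * (6 * suc μ * J)) * (J * suc c + 2 * (2 * (J * suc c)))
      ≡⟨ solve 3 (λ J u c → con 3 :* J :* (con 2 :* (con 6 :* u :* J)) :* (J :* c :+ con 2 :* (con 2 :* (J :* c)))
                          := con 180 :* c :* (J :* (J :* (J :* con 1))) :* u) refl J (suc μ) (suc c) ⟩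
    180 * suc c * J ^ 3 * suc μ ∎
    where
    radius≤ : suc ((3 + μ) * J) ≤ 6 * suc μ * J
    radius≤ = begin
      1 + (3 + μ) * J           ≤⟨ +-mono-≤ {1} {3 * J} (s≤s z≤n) (*-monoˡ-≤ J (+-monoʳ-≤ 3 (m≤n*m μ 3))) ⟩
      3 * J + (3 + 3 * μ) * J   ≡⟨ solve 2 (λ J m → con 3 :* J :+ (con 3 :+ con 3 :* m) :* J := (con 6 :+ con 3 :* m) :* J) refl J μ ⟩
      (6 + 3 * μ) * J           ≤⟨ *-monoˡ-≤ J (+-monoʳ-≤ 6 (*-monoˡ-≤ μ (m≤m+n 3 3))) ⟩
      (6 + 6 * μ) * J           ≡⟨ cong (_* J) (*-suc 6 μ) ⟨
      6 * suc μ * J             ∎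

theorem1p1 : ∀ (c : ℕ) → ∃[ C ]
    ∀ (d n Δ a : ℕ) (ε : ℝ) → InUnitInterval ε →
    ∀ (k : ℕ) → k ≡⌈ a *1+ ε ⌉ →
    Σ[ r ∈ ℕ ] (r ≤[ C * ⌈log₂ suc n ⌉ ^ 3 / ε ]) ×
    (Σ[ b ∈ ℕ ] Σ[ 𝒜 ∈ LocalAlgorithm b ]
    (∀ (G : Multigraph) → Multigraph.#V G ≤ n →
    (∀ v → degree G v ≤ Δ) →
    ∀ (a* : ℕ) → IsPseudoArboricity G a* → a* ≤ a →
    ∀ (N : Network G (d * ⌈log₂ suc n ⌉)) →
    ObtainsOrientation N 𝒜 r k n c))
theorem1p1 c = 180 * suc c , λ d n Δ a ε ε∈ k k≡ →
  -- From 1/(μ+3) < ε < 1/(μ+1), the lower bound supplies the slack of the augmentation, with m = μ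
  -- + 2, and the upper one turns a factor μ + 1 in the number of rounds into 1/ε.
  let (μ , l , u) = reciprocal ε ε∈
      J = ⌈log₂ suc n ⌉
      s = d * J
      open FailureProbability c s Δ k (2 + μ) J
      open Correctness s Δ k (2 + μ) J T B
      open Algorithm s Δ k R T B
  in depth (allFin T) , ≤/ε ε {depth (allFin T)} {180 * suc c * J ^ 3} u (rounds-bound c s Δ k μ J) , T * B , algorithm ,
     λ G V≤n deg≤Δ a* (parts , _) a*≤a N →
       obtains N deg≤Δ parts
         -- `k` is computed from the known bound `a`, while the pseudo-forests number `a*`; a
         -- smaller `a*` only increases the slack.
         (≤-trans (*-monoˡ-≤ (4 + μ) a*≤a) (*1+⇒ ε {a} {k} l (proj₁ k≡)))
         (≤-trans (s≤s V≤n) (≤2^⌈log₂⌉ (suc n)))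
         (≤-trans (n≤1+n n) (≤2^⌈log₂⌉ (suc n)))
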